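{- Let $k\ge2$. (1) $S(\mathrm{TEP},2)=k^2$, and it is achieved at $\ell=k+1$ and at $\ell=k+2$, i.e. $S((\mathrm{TEP},2),k+1)=S((\mathrm{TEP},2),k+2)=k^2$. (2) $S(\mathrm{TEP},3)\ge k^3/16$ for $k\ge4$. (3) $S(\mathrm{TEP},h)\le k^h-k^{h-2}(k-2)$ for $h\ge3$; in particular $S(\mathrm{TEP},h)<k^h$ for $h\ge3$ and $k\ge3$.
   Context: Tree Evaluation Problem: $(\mathrm{TEP},1):[k]\to[k]$ is the identity; for $h\ge2$, $(\mathrm{TEP},h):[k]^{n_h}\to[k]$, $n_h=(2^{h-1}-1)k^2+2^{h-1}$, takes as input a complete binary tree of height $h$ (a root with two leaves has height 2) whose leaves carry values in $[k]$ and whose internal nodes carry matrices in $[k]^{k\times k}$ (each entry an input variable); a leaf's value is its label, an internal node with matrix $M$ has value $M(a,b)$ where $a,b$ are its children's values, and the output is the root's value. For $A\subseteq[n_h]$, $(\mathrm{TEP},h)_A$ is the matrix with rows indexed by $\alpha\in[k]^A$, columns by assignments to $[n_h]\setminus A$, entry the value of $(\mathrm{TEP},h)$; $\mathsf{nrows}$ denotes its number of distinct rows. $S((\mathrm{TEP},h),\ell)=\min_{A\subseteq[n_h],|A|=\ell}\mathsf{nrows}((\mathrm{TEP},h)_A)$ and $S(\mathrm{TEP},h)=\max_{1\le\ell\le n_h}S((\mathrm{TEP},h),\ell)$. -}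

module Defs where

open import Data.Nat using (ℕ; zero; suc; _+_; _*_; _∸_; _⊓_; _⊔_)
open import Data.Nat.Properties as ℕP using ()
open import Data.Bool using (Bool; true; false; if_then_else_)
open import Data.Fin using (Fin; zero; suc; _↑ˡ_; _↑ʳ_; combine)
open import Data.Fin.Properties using (_≟_)
open import Data.Fin.Subset using (Subset; ∣_∣)
open import Data.Vec using (Vec; []; _∷_; lookup)
open import Data.List using (List; []; _∷_; [_]; map; concatMap; filter; length; foldr; deduplicate; upTo; allFin)
open import Data.List.Properties using (≡-dec)

allFuns : (n k : ℕ) → List (Fin n → Fin k)
allFuns zero    k = [ (λ ()) ]
allFuns (suc n) k =
  concatMap (λ a → map (λ g → λ { zero → a ; (suc i) → g i }) (allFuns n k)) (allFin k)

allSubsets : (n : ℕ) → List (Subset n)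
allSubsets zero    = [ [] ]
allSubsets (suc n) = concatMap (λ b → map (b ∷_) (allSubsets n)) (true ∷ false ∷ [])

merge : {n k : ℕ} → Subset n → (Fin n → Fin k) → (Fin n → Fin k) → Fin n → Fin k
merge A α β i = if lookup A i then α i else β i

-- the row of f_A indexed by (the restriction to A of) α: values over all columns
row : {n k : ℕ} → ((Fin n → Fin k) → Fin k) → Subset n → (Fin n → Fin k) → List (Fin k)
row {n} {k} f A α = map (λ β → f (merge A α β)) (allFuns n k)

nrows : {n k : ℕ} → ((Fin n → Fin k) → Fin k) → Subset n → ℕ
nrows {n} {k} f A = length (deduplicate (≡-dec _≟_) (map (row f A) (allFuns n k)))

minOf : List ℕ → ℕ
minOf []       = 0
minOf (x ∷ xs) = foldr _⊓_ x xs

maxOf : List ℕ → ℕ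
maxOf = foldr _⊔_ 0

Sℓ : {n k : ℕ} → ((Fin n → Fin k) → Fin k) → ℕ → ℕ
Sℓ {n} f ℓ = minOf (map (nrows f) (filter (λ A → ∣ A ∣ ℕP.≟ ℓ) (allSubsets n)))

Smax : {n k : ℕ} → ((Fin n → Fin k) → Fin k) → ℕ
Smax {n} f = maxOf (map (λ i → Sℓ f (suc i)) (upTo n))

-- number of variables of a tree of depth d (height d+1):
-- one leaf variable, or a k×k root matrix followed by two subtrees
sz : ℕ → ℕ → ℕ
sz k zero    = 1
sz k (suc d) = k * k + (sz k d + sz k d)

-- evaluation of a tree of depth d; variable layout: root matrix entries
-- (index combine a b for entry (a,b)), then left subtree, then right subtree
tep : (k d : ℕ) → (Fin (sz k d) → Fin k) → Fin k
tep k zero    x = x zero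
tep k (suc d) x = x (combine a b ↑ˡ (sz k d + sz k d))
  where
  a = tep k d (λ j → x ((k * k) ↑ʳ (j ↑ˡ sz k d)))
  b = tep k d (λ j → x ((k * k) ↑ʳ (sz k d ↑ʳ j)))

nVars : ℕ → ℕ → ℕ
nVars k h = sz k (h ∸ 1)

TEP : (k h : ℕ) → (Fin (nVars k h) → Fin k) → Fin k
TEP k h = tep k (h ∸ 1)

{-# OPTIONS --safe #-}
-- The number of rows is bounded above by encoding the assignments to A so that the code determines
-- the row, and below by families of assignments whose rows are pairwise separated.
--
-- Height 2: one leaf and at most one entry per matrix row give the code (a, M(a,b)); both leaves and m
-- entries leave k constants and k² − m projections. For |A| = k + 1 or k + 2 no choice of A does better.
--
-- Height h ≥ 3, upper bound: take the left subtree first, then the right one, then the root matrix. The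
-- induction needs k² − k + 2 per value of the left subtree, which height 2 alone does not give for
-- k + 1 ≤ ℓ ≤ 2k − 1. There one reads the root matrix instead: with the left value known, at most two
-- entries per row, and one in the first row, cost (k − 1)k² + k.
--
-- Height 3, lower bound: let |A| = k² + 2sk + 4. More than s entries of A in a row of some matrix cost
-- k^(s+1) rows, unless the variables that select within that row are all in A. Avoiding this forces all
-- four leaves into A and, after swapping the subtrees if necessary, leaves at least (k² − 2sk)/2 entries
-- of the right matrix outside A. They give distinct rows for each of the k values of the left subtree.
-- Take s = 1 for k = 4 and s = 2 for k ≥ 5.
module Submission where

open import Defs
open import Data.Nat
  using (ℕ; zero; suc; _+_; _*_; _∸_; _^_; _⊓_; _≤_; _<_; z≤n; s≤s; s≤s⁻¹; >-nonZero)
open import Data.Nat.Properties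
open import Data.Nat.Tactic.RingSolver using (solve-∀)
open import Data.Bool using (Bool; true; false; if_then_else_; not)
open import Data.Bool.Properties using () renaming (_≟_ to _≟ᵇ_)
open import Data.Fin
  using (Fin; zero; suc; _↑ˡ_; _↑ʳ_; combine; remQuot; splitAt; join; inject≤; finToFun; funToFin; fromℕ<; toℕ)
import Data.Fin.Properties as FP
open import Data.Fin.Subset using (Subset; ∣_∣)
open import Data.Product using (Σ; ∃; ∃₂; _×_; _,_; proj₁; proj₂; uncurry; swap)
open import Data.Product.Properties using (≡-dec)
open import Data.Sum using (_⊎_; inj₁; inj₂)
open import Data.Sum.Properties using (inj₁-injective; inj₂-injective)
open import Data.Vec using (_∷_; []; lookup; tabulate)
open import Data.Vec.Properties using (lookup∘tabulate)
open import Data.Vec.Functional using (_++_)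
open import Data.Vec.Functional.Properties using (lookup-++ˡ; lookup-++ʳ)
open import Data.List as List using (List; _∷_; []; map; foldr; deduplicate)
import Data.List.Properties as ListP
open import Data.List.Membership.Propositional using (_∈_; lose)
open import Data.List.Membership.Propositional.Properties
open import Data.List.Relation.Unary.Any as Any using (here; there)
open import Data.List.Relation.Unary.Any.Properties using (lookup-index)
open import Data.List.Relation.Unary.All as All using ()
open import Data.List.Relation.Unary.AllPairs using (_∷_)
open import Data.List.Relation.Unary.Unique.Propositional using (Unique)
import Data.List.Relation.Unary.Unique.DecPropositional.Properties as UDP
open import Function using (_∘_; id; flip; case_of_; const)
open import Relation.Binary.Definitions using (DecidableEquality)
open import Relation.Binary.PropositionalEquality
open import Relation.Nullary using (Dec; yes; no; contradiction)
open import Relation.Nullary.Decidable using (_×-dec_; ¬?)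

private variable
  κ m n N : ℕ

-- Counting

all none : Fin n → Bool
all  _ = true
none _ = false

bit : Bool → ℕ
bit true  = 1
bit false = 0

count : (Fin n → Bool) → ℕ
count {zero}  p = 0
count {suc n} p = bit (p zero) + count (p ∘ suc)

count-cong : {p q : Fin n → Bool} → p ≗ q → count p ≡ count q
count-cong {zero}  e = refl
count-cong {suc n} e = cong₂ _+_ (cong bit (e zero)) (count-cong (e ∘ suc))

count-splitAt : ∀ m (p : Fin (m + n) → Bool) → count p ≡ count (p ∘ (_↑ˡ n)) + count (p ∘ (m ↑ʳ_))
count-splitAt zero    p = refl
count-splitAt (suc m) p =
  trans (cong (bit (p zero) +_) (count-splitAt m (p ∘ suc))) (sym (+-assoc (bit (p zero)) _ _))

count-all : count {n} all ≡ n
count-all {zero}  = refl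
count-all {suc n} = cong suc (count-all {n})

count-none : count {n} none ≡ 0
count-none {zero}  = refl
count-none {suc n} = count-none {n}

count-not : (p : Fin n → Bool) → count p + count (not ∘ p) ≡ n
count-not {zero}  p = refl
count-not {suc n} p with p zero
... | true  = cong suc (count-not (p ∘ suc))
... | false = trans (+-suc _ _) (cong suc (count-not (p ∘ suc)))

count-subadditive : {p q r : Fin n → Bool} → (∀ i → bit (p i) ≤ bit (q i) + bit (r i)) →
                    count p ≤ count q + count r
count-subadditive {zero} le = z≤n
count-subadditive {suc n} {p} {q} {r} le = begin
  bit (p zero) + count (p ∘ suc)
    ≤⟨ +-mono-≤ (le zero) (count-subadditive (le ∘ suc)) ⟩
  (bit (q zero) + bit (r zero)) + (count (q ∘ suc) + count (r ∘ suc))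
    ≡⟨ interchange (bit (q zero)) (bit (r zero)) (count (q ∘ suc)) _ ⟩
  (bit (q zero) + count (q ∘ suc)) + (bit (r zero) + count (r ∘ suc)) ∎
  where
  open ≤-Reasoning
  open import Algebra.Properties.CommutativeSemigroup +-commutativeSemigroup using (interchange)

-- An encoding comes with the largest set of entries it can handle; this cuts such a set down to any
-- smaller prescribed size.
thin : (p : Fin n → Bool) → m ≤ count p →
       Σ (Fin n → Bool) λ q → (∀ i → q i ≡ true → p i ≡ true) × count q ≡ m
thin {n} {zero} p le = none , (λ _ ()) , count-none {n}
thin {suc n} {suc m} p le with p zero in eq
... | false = let q , sub , c = thin (p ∘ suc) le in
              (λ { zero → false ; (suc i) → q i }) , (λ { zero () ; (suc i) → sub i }) , c
... | true  = let q , sub , c = thin (p ∘ suc) (s≤s⁻¹ le) in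
              (λ { zero → true ; (suc i) → q i }) , (λ { zero _ → eq ; (suc i) → sub i }) , cong suc c

thinAll : ∀ {n ℓ} → ℓ ≤ n → Σ (Fin n → Bool) λ p → count p ≡ ℓ
thinAll {n} ℓ≤n = let q , _ , c = thin {n} all (subst (_ ≤_) (sym (count-all {n})) ℓ≤n) in q , c

-- Together with `rank` this turns counts into injections between finite types, so that inequalities
-- between counts follow from `injective⇒≤`.
enumerate : (p : Fin n → Bool) →
            Σ (Fin (count p) → Fin n) λ h → (∀ i → p (h i) ≡ true) × (∀ {i j} → h i ≡ h j → i ≡ j)
enumerate {zero} p = (λ ()) , (λ ()) , λ { {()} }
enumerate {suc n} p with p zero in eq | enumerate (p ∘ suc)
... | false | h , holds , inj = suc ∘ h , holds , inj ∘ FP.suc-injective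
... | true  | h , holds , inj =
  (λ { zero → zero ; (suc i) → suc (h i) }) ,
  (λ { zero → eq ; (suc i) → holds i }) ,
  λ { {zero} {zero} e → refl ; {zero} {suc _} () ; {suc _} {zero} ()
    ; {suc _} {suc _} e → cong suc (inj (FP.suc-injective e)) }

rank : (p : Fin n → Bool) →
       Σ (∀ i → p i ≡ true → Fin (count p)) λ r →
       ∀ {i j} (pi : p i ≡ true) (pj : p j ≡ true) → r i pi ≡ r j pj → i ≡ j
rank {zero} p = (λ ()) , λ { {()} }
rank {suc n} p with p zero in eq | rank (p ∘ suc)
... | false | r , inj =
  (λ { zero e → contradiction (trans (sym eq) e) λ () ; (suc i) → r i }) ,
  λ { {zero} e _ → contradiction (trans (sym eq) e) λ ()
    ; {suc _} {zero} _ e → contradiction (trans (sym eq) e) λ ()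
    ; {suc _} {suc _} pi pj e → cong suc (inj pi pj e) }
... | true  | r , inj =
  (λ { zero _ → zero ; (suc i) pi → suc (r i pi) }) ,
  λ { {zero} {zero} _ _ _ → refl ; {zero} {suc _} _ _ () ; {suc _} {zero} _ _ ()
    ; {suc _} {suc _} pi pj e → cong suc (inj pi pj (FP.suc-injective e)) }

count-≤-embedding : (p : Fin m → Bool) (q : Fin n → Bool) (h : Fin m → Fin n) →
                    (∀ {i j} → h i ≡ h j → i ≡ j) → (∀ i → p i ≡ true → q (h i) ≡ true) →
                    count p ≤ count q
count-≤-embedding p q h h-inj imp =
  let e , holds , e-inj = enumerate p
      r , r-inj = rank q
  in FP.injective⇒≤ {f = λ i → r (h (e i)) (imp (e i) (holds i))} (e-inj ∘ h-inj ∘ r-inj _ _)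

private
  isYes : {P : Set} → Dec P → Bool
  isYes (yes _) = true
  isYes (no _)  = false

  isYes-true : {P : Set} {d : Dec P} → isYes d ≡ true → P
  isYes-true {d = yes p} _ = p

-- Pigeonhole: if every fibre of `g` inside `p` has at most `s` elements, adding up the `κ` fibres
-- bounds the count; otherwise some fibre supplies `s + 1` distinct elements.
count-fibres : ∀ {s} (p : Fin n → Bool) (g : Fin n → Fin κ) →
  (Σ (Fin κ) λ u → Σ (Fin (suc s) → Fin n) λ h →
     (∀ {i j} → h i ≡ h j → i ≡ j) × (∀ i → p (h i) ≡ true × g (h i) ≡ u))
  ⊎ count p ≤ s * κ
count-fibres {n} {κ} {s} p g with FP.all? (λ u → count (fibre u) ≤? s)
  where
  fibre : Fin κ → Fin n → Bool
  fibre u i = if p i then isYes (g i FP.≟ u) else false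
... | yes small = inj₂ (subst (_≤ s * κ) (count-cong (λ i → below-all i)) (below-bound κ ≤-refl))
  where
  -- `below j` is the part of `p` over the first `j` values of `g`. Passing from `j` to `j + 1` adds
  -- a single fibre, hence at most `s` elements.
  below : ℕ → Fin n → Bool
  below j i = if p i then isYes (toℕ (g i) <? j) else false

  below-all : ∀ i → below κ i ≡ p i
  below-all i with p i
  ... | false = refl
  ... | true with toℕ (g i) <? κ
  ...   | yes _ = refl
  ...   | no g≮κ = contradiction (FP.toℕ<n (g i)) g≮κ

  below-bound : ∀ j → j ≤ κ → count (below j) ≤ s * j
  below-bound zero _ = subst (_≤ s * 0) (sym (trans (count-cong empty) (count-none {n}))) z≤n
    where
    empty : ∀ i → below 0 i ≡ false
    empty i with p i
    ... | true  = refl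
    ... | false = refl
  below-bound (suc j) j<κ = begin
    count (below (suc j))
      ≤⟨ count-subadditive step ⟩
    count (below j) + count (λ i → if p i then isYes (g i FP.≟ fromℕ< j<κ) else false)
      ≤⟨ +-mono-≤ (below-bound j (<⇒≤ j<κ)) (small (fromℕ< j<κ)) ⟩
    s * j + s
      ≡⟨ +-comm (s * j) s ⟩
    s + s * j
      ≡⟨ *-suc s j ⟨
    s * suc j ∎
    where
    open ≤-Reasoning
    step : ∀ i → bit (below (suc j) i) ≤
                 bit (below j i) + bit (if p i then isYes (g i FP.≟ fromℕ< j<κ) else false)
    step i with p i
    ... | false = z≤n
    ... | true with toℕ (g i) <? suc j | toℕ (g i) <? j | g i FP.≟ fromℕ< j<κ
    ...   | no _ | _ | _ = z≤n
    ...   | yes _ | yes _ | _ = s≤s z≤n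
    ...   | yes _ | no _ | yes _ = ≤-refl
    ...   | yes le | no nl | no ne =
      contradiction (FP.toℕ-injective (trans (≤-antisym (s≤s⁻¹ le) (≮⇒≥ nl)) (sym (FP.toℕ-fromℕ< j<κ)))) ne
... | no ¬small =
  let u , big = FP.¬∀⟶∃¬ κ _ (λ u → count (fibre u) ≤? s) ¬small
      h , holds , inj = enumerate (fibre u)
      c = λ i → inject≤ i (≰⇒> big)
  in inj₁ (u , h ∘ c , (λ {i} {j} → FP.inject≤-injective (≰⇒> big) (≰⇒> big) i j ∘ inj)
          , λ i → split u (h (c i)) (holds (c i)))
  where
  fibre : Fin κ → Fin n → Bool
  fibre u i = if p i then isYes (g i FP.≟ u) else false

  split : ∀ u i → fibre u i ≡ true → p i ≡ true × g i ≡ u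
  split u i e with p i
  ... | true = refl , isYes-true e

-- Enumerated subsets and assignments, minima and maxima

∣∣≡count : (A : Subset n) → ∣ A ∣ ≡ count (lookup A)
∣∣≡count []          = refl
∣∣≡count (true  ∷ A) = cong suc (∣∣≡count A)
∣∣≡count (false ∷ A) = ∣∣≡count A

∣tabulate∣ : (p : Fin n → Bool) → ∣ tabulate p ∣ ≡ count p
∣tabulate∣ p = trans (∣∣≡count (tabulate p)) (count-cong (lookup∘tabulate p))

∈-allSubsets : (A : Subset n) → A ∈ allSubsets n
∈-allSubsets []      = here refl
∈-allSubsets (b ∷ A) = ∈-concatMap⁺ (λ b → map (b ∷_) (allSubsets _)) (lose (bool∈ b) (∈-map⁺ (b ∷_) (∈-allSubsets A)))
  where
  bool∈ : ∀ b → b ∈ true ∷ false ∷ []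
  bool∈ true  = here refl
  bool∈ false = there (here refl)

-- Without function extensionality the listed function agrees with `g` only pointwise. This is why
-- rows are compared under the hypothesis `Extensional`.
∈-allFuns : (g : Fin n → Fin κ) → ∃ λ g′ → g′ ∈ allFuns n κ × g′ ≗ g
∈-allFuns {zero}  g = _ , here refl , λ ()
∈-allFuns {suc n} g =
  let g′ , g′∈ , g′≗g = ∈-allFuns (g ∘ suc) in
  _ , ∈-concatMap⁺ _ (lose (∈-allFin (g zero)) (∈-map⁺ _ g′∈)) , λ { zero → refl ; (suc i) → g′≗g i }

minOf-≤ : ∀ {x} xs → x ∈ xs → minOf xs ≤ x
minOf-≤ (y ∷ xs) (here refl) = fold≤init y xs
  where
  fold≤init : ∀ y xs → foldr _⊓_ y xs ≤ y
  fold≤init y []       = ≤-refl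
  fold≤init y (x ∷ xs) = ≤-trans (m⊓n≤n x _) (fold≤init y xs)
minOf-≤ (y ∷ xs) (there x∈) = fold≤ xs x∈
  where
  fold≤ : ∀ {x} xs → x ∈ xs → foldr _⊓_ y xs ≤ x
  fold≤ (x ∷ xs) (here refl) = m⊓n≤m x _
  fold≤ (x ∷ xs) (there x∈)  = ≤-trans (m⊓n≤n x _) (fold≤ xs x∈)

-- The minimum of a nonempty list is one of its members. The membership witness excludes the empty
-- list, where `minOf` has the default value 0.
minOf-elim : (P : ℕ → Set) → ∀ {x xs} → x ∈ xs → (∀ {y} → y ∈ xs → P y) → P (minOf xs)
minOf-elim P {xs = y ∷ xs} _ holds = go xs (holds ∘ there)
  where
  go : ∀ xs → (∀ {y} → y ∈ xs → P y) → P (foldr _⊓_ y xs)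
  go []       _ = holds (here refl)
  go (x ∷ xs) h with ⊓-sel x (foldr _⊓_ y xs)
  ... | inj₁ e = subst P (sym e) (h (here refl))
  ... | inj₂ e = subst P (sym e) (go xs (h ∘ there))

maxOf-≤ : ∀ xs → (∀ {y} → y ∈ xs → y ≤ N) → maxOf xs ≤ N
maxOf-≤ []       le = z≤n
maxOf-≤ (x ∷ xs) le = ⊔-lub (le (here refl)) (maxOf-≤ xs (le ∘ there))

≤-maxOf : ∀ {x} xs → x ∈ xs → x ≤ maxOf xs
≤-maxOf (x ∷ xs) (here refl) = m≤m⊔n x _
≤-maxOf (x ∷ xs) (there x∈)  = ≤-trans (≤-maxOf xs x∈) (m≤n⊔m x _)

module _ (f : (Fin n → Fin κ) → Fin κ) where

  Sℓ-≤ : (A : Subset n) → nrows f A ≤ N → Sℓ f ∣ A ∣ ≤ N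
  Sℓ-≤ A = ≤-trans (minOf-≤ _ (∈-map⁺ (nrows f) (∈-filter⁺ _ (∈-allSubsets A) refl)))

  Sℓ-elim : (P : ℕ → Set) → ∀ {ℓ} → ℓ ≤ n → (∀ A → ∣ A ∣ ≡ ℓ → P (nrows f A)) → P (Sℓ f ℓ)
  Sℓ-elim P {ℓ} ℓ≤n holds = minOf-elim P
    (∈-map⁺ (nrows f)
      (∈-filter⁺ (λ A → ∣ A ∣ ≟ ℓ) (∈-allSubsets (tabulate q)) (trans (∣tabulate∣ q) (proj₂ thinned))))
    λ y∈ → let A , A∈ , y≡ = ∈-map⁻ (nrows f) y∈ in
           subst P (sym y≡) (holds A (proj₂ (∈-filter⁻ (λ A → ∣ A ∣ ≟ ℓ) {xs = allSubsets n} A∈)))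
    where
    thinned = thinAll {n} ℓ≤n
    q = proj₁ thinned

  Smax-≤ : (∀ ℓ → suc ℓ ≤ n → Sℓ f (suc ℓ) ≤ N) → Smax f ≤ N
  Smax-≤ {N} le = maxOf-≤ _ λ y∈ →
    let ℓ , ℓ∈ , y≡ = ∈-map⁻ (λ i → Sℓ f (suc i)) y∈ in
    subst (_≤ N) (sym y≡) (le ℓ (∈-upTo⁻ ℓ∈))

  Sℓ≤Smax : ∀ {ℓ} → suc ℓ ≤ n → Sℓ f (suc ℓ) ≤ Smax f
  Sℓ≤Smax ℓ<n = ≤-maxOf _ (∈-map⁺ (λ i → Sℓ f (suc i)) (∈-upTo⁺ ℓ<n))

-- Numbers of rows

Extensional : ((Fin n → Fin κ) → Fin κ) → Set
Extensional f = ∀ {x y} → x ≗ y → f x ≡ f y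

Unique-lookup-injective : {A : Set} {xs : List A} → Unique xs → ∀ {i j} →
                          List.lookup xs i ≡ List.lookup xs j → i ≡ j
Unique-lookup-injective (x∉ ∷ u) {zero}  {zero}  e = refl
Unique-lookup-injective (x∉ ∷ u) {zero}  {suc j} e = contradiction e (All.lookup x∉ (∈-lookup j))
Unique-lookup-injective (x∉ ∷ u) {suc i} {zero}  e = contradiction (sym e) (All.lookup x∉ (∈-lookup i))
Unique-lookup-injective (x∉ ∷ u) {suc i} {suc j} e = cong suc (Unique-lookup-injective u e)

-- This is `merge` for a set given as a Boolean predicate, a form in which sets of variables can be
-- assembled blockwise with `_++_`.
mix : (Fin n → Bool) → (Fin n → Fin κ) → (Fin n → Fin κ) → Fin n → Fin κ
mix p α β i = if p i then α i else β i

module _ {p : Fin n → Bool} {α β : Fin n → Fin κ} {i : Fin n} where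

  mix-in : p i ≡ true → mix p α β i ≡ α i
  mix-in = cong (λ b → if b then α i else β i)

  mix-out : p i ≡ false → mix p α β i ≡ β i
  mix-out = cong (λ b → if b then α i else β i)

  mix-same : ∀ {v} → α i ≡ v → β i ≡ v → mix p α β i ≡ v
  mix-same eα eβ with p i
  ... | true  = eα
  ... | false = eβ

-- `encode` sees the whole assignment and may even read variables outside `p`: to bound the number
-- of rows it is enough that equal codes give equal rows.
record Code (f : (Fin n → Fin κ) → Fin κ) (p : Fin n → Bool) (N : ℕ) : Set where
  constructor code
  field
    encode     : (Fin n → Fin κ) → Fin N
    determines : ∀ α α′ → encode α ≡ encode α′ → ∀ β → f (mix p α β) ≡ f (mix p α′ β)

module _ {f : (Fin n → Fin κ) → Fin κ} (f-ext : Extensional f) where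

  private
    _≟ʳ_ : DecidableEquality (List (Fin κ))
    _≟ʳ_ = ListP.≡-dec FP._≟_

  -- Each distinct row comes from some assignment; taking the code of that assignment is injective
  -- because the deduplicated list has no repetitions.
  nrows-≤ : ∀ {p} → Code f p N → nrows f (tabulate p) ≤ N
  nrows-≤ {p = p} (code encode determines) = FP.injective⇒≤ {f = encode ∘ preimage} λ {i} {j} e →
    Unique-lookup-injective (UDP.deduplicate-! _≟ʳ_ (map (row f A) (allFuns n κ)))
      (trans (is-row i) (trans (ListP.map-cong (same-row e) (allFuns n κ)) (sym (is-row j))))
    where
    A = tabulate p
    rows = deduplicate _≟ʳ_ (map (row f A) (allFuns n κ))
    origin : ∀ i → ∃ λ α → α ∈ allFuns n κ × List.lookup rows i ≡ row f A α
    origin i = ∈-map⁻ (row f A) (∈-deduplicate⁻ _≟ʳ_ _ (∈-lookup {xs = rows} i))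
    preimage = λ i → proj₁ (origin i)
    is-row = λ i → proj₂ (proj₂ (origin i))
    merge≗mix : ∀ α β → merge A α β ≗ mix p α β
    merge≗mix α β i = cong (λ b → if b then α i else β i) (lookup∘tabulate p i)
    same-row : ∀ {α α′} → encode α ≡ encode α′ → ∀ β → f (merge A α β) ≡ f (merge A α′ β)
    same-row {α} {α′} e β =
      trans (f-ext (merge≗mix α β)) (trans (determines α α′ e β) (sym (f-ext (merge≗mix α′ β))))

  -- Sending an index to the position of its row in the deduplicated list is injective. A row
  -- records only the listed `β`; extensionality carries equality of rows over to all `β`, as
  -- separation requires.
  ≤-nrows : {X : Set} (e : Fin N → X) → (∀ {i j} → e i ≡ e j → i ≡ j) →
            ∀ A (α : X → Fin n → Fin κ) →
            (∀ x y → (∀ β → f (merge A (α x) β) ≡ f (merge A (α y) β)) → x ≡ y) →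
            N ≤ nrows f A
  ≤-nrows {N} e e-inj A α separated =
    FP.injective⇒≤ {f = Any.index ∘ found} λ {i} {j} eq →
      e-inj (separated _ _ (separate i j
        (trans (lookup-index (found i)) (trans (cong (List.lookup rows) eq) (sym (lookup-index (found j)))))))
    where
    rows = deduplicate _≟ʳ_ (map (row f A) (allFuns n κ))
    α′ : Fin N → Fin n → Fin κ
    α′ i = proj₁ (∈-allFuns (α (e i)))
    α′≗α : ∀ i → α′ i ≗ α (e i)
    α′≗α i = proj₂ (proj₂ (∈-allFuns (α (e i))))
    found : ∀ i → row f A (α′ i) ∈ rows
    found i = ∈-deduplicate⁺ _≟ʳ_ (∈-map⁺ (row f A) (proj₁ (proj₂ (∈-allFuns (α (e i))))))
    merge-cong : ∀ {x x′ y y′ : Fin n → Fin κ} → x ≗ x′ → y ≗ y′ → merge A x y ≗ merge A x′ y′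
    merge-cong ex ey i with lookup A i
    ... | true  = ex i
    ... | false = ey i
    pointwise : ∀ {g h : (Fin n → Fin κ) → Fin κ} {xs β} → map g xs ≡ map h xs → β ∈ xs → g β ≡ h β
    pointwise {xs = _ ∷ _} eq (here refl) = proj₁ (ListP.∷-injective eq)
    pointwise {xs = _ ∷ _} eq (there β∈)  = pointwise (proj₂ (ListP.∷-injective eq)) β∈
    separate : ∀ i j → row f A (α′ i) ≡ row f A (α′ j) →
               ∀ β → f (merge A (α (e i)) β) ≡ f (merge A (α (e j)) β)
    separate i j eq β = let β′ , β′∈ , β′≗β = ∈-allFuns β in
      trans (f-ext (merge-cong (λ x → sym (α′≗α i x)) (λ x → sym (β′≗β x))))
        (trans (pointwise eq β′∈) (f-ext (merge-cong (α′≗α j) β′≗β)))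

-- Upper bounds

tep-ext : ∀ k d → Extensional (tep k d)
tep-ext k zero    e = e zero
tep-ext k (suc d) {x} e = trans
  (cong₂ (λ a b → x (combine a b ↑ˡ (sz k d + sz k d)))
    (tep-ext k d λ j → e (k * k ↑ʳ (j ↑ˡ sz k d)))
    (tep-ext k d λ j → e (k * k ↑ʳ (sz k d ↑ʳ j))))
  (e _)

Code-mono : ∀ {f : (Fin n → Fin κ) → Fin κ} {p M} → M ≤ N → Code f p M → Code f p N
Code-mono M≤N (code encode determines) = code
  (λ α → inject≤ (encode α) M≤N)
  λ α α′ e → determines α α′ (FP.inject≤-injective M≤N M≤N _ _ e)

-- Codes for a tree from codes for its parts

module _ (k d : ℕ) where

  node : (Fin (k * k) → Bool) → (Fin (sz k d) → Bool) → (Fin (sz k d) → Bool) → Fin (sz k (suc d)) → Bool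
  node p q r = p ++ (q ++ r)

  count-node : ∀ p q r → count (node p q r) ≡ count p + (count q + count r)
  count-node p q r = trans (count-++ p (q ++ r)) (cong (count p +_) (count-++ q r))
    where
    count-++ : ∀ {a b} (p : Fin a → Bool) (q : Fin b → Bool) → count (p ++ q) ≡ count p + count q
    count-++ {a} {b} p q = trans (count-splitAt a (p ++ q))
      (cong₂ _+_ (count-cong (lookup-++ˡ p q)) (count-cong (lookup-++ʳ p q)))

  matrixPart : (Fin (sz k (suc d)) → Fin k) → Fin (k * k) → Fin k
  matrixPart x = x ∘ (_↑ˡ (sz k d + sz k d))

  leftPart rightPart : (Fin (sz k (suc d)) → Fin k) → Fin (sz k d) → Fin k
  leftPart  x = x ∘ (k * k ↑ʳ_) ∘ (_↑ˡ sz k d)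
  rightPart x = x ∘ (k * k ↑ʳ_) ∘ (sz k d ↑ʳ_)

  tep-mix-node : ∀ p q r α β → tep k (suc d) (mix (node p q r) α β) ≡
    mix p (matrixPart α) (matrixPart β)
      (combine (tep k d (mix q (leftPart α) (leftPart β))) (tep k d (mix r (rightPart α) (rightPart β))))
  tep-mix-node p q r α β = trans
    (cong₂ (λ a b → mix (node p q r) α β (combine a b ↑ˡ (sz k d + sz k d)))
      (tep-ext k d λ j → cong (λ b → if b then leftPart α j else leftPart β j)
        (trans (lookup-++ʳ p (q ++ r) (j ↑ˡ sz k d)) (lookup-++ˡ q r j)))
      (tep-ext k d λ j → cong (λ b → if b then rightPart α j else rightPart β j)
        (trans (lookup-++ʳ p (q ++ r) (sz k d ↑ʳ j)) (lookup-++ʳ q r j))))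
    (cong (λ b → if b then matrixPart α i else matrixPart β i) (lookup-++ˡ p (q ++ r) i))
    where
    i = combine (tep k d (mix q (leftPart α) (leftPart β))) (tep k d (mix r (rightPart α) (rightPart β)))

  private
    via : ∀ p q r α α′ β → let mixed = λ α → mix p (matrixPart α) (matrixPart β)
                                         (combine (tep k d (mix q (leftPart α) (leftPart β)))
                                                  (tep k d (mix r (rightPart α) (rightPart β)))) in
          mixed α ≡ mixed α′ →
          tep k (suc d) (mix (node p q r) α β) ≡ tep k (suc d) (mix (node p q r) α′ β)
    via p q r α α′ β e = trans (tep-mix-node p q r α β) (trans e (sym (tep-mix-node p q r α′ β)))

    mix-agree : ∀ {p : Fin n → Bool} {α α′ β : Fin n → Fin κ} i → (p i ≡ true → α i ≡ α′ i) →
                mix p α β i ≡ mix p α′ β i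
    mix-agree {p = p} i e with p i
    ... | true  = e refl
    ... | false = refl

  -- The assignment to `p` influences the output only through the value of the left subtree.
  Code-left : ∀ {p} → Code (tep k d) p N → Code (tep k (suc d)) (node none p none) N
  Code-left {p = p} (code encode determines) = code
    (encode ∘ leftPart)
    λ α α′ e β → via none p none α α′ β
      (cong (λ u → matrixPart β (combine u (tep k d (rightPart β)))) (determines _ _ e (leftPart β)))

  -- A fully known left subtree matters only through its value, which accounts for the factor `k`.
  Code-right : ∀ {p} → Code (tep k d) p N → Code (tep k (suc d)) (node none all p) (k * N)
  Code-right {p = p} (code encode determines) = code
    (λ α → combine (tep k d (leftPart α)) (encode (rightPart α)))
    λ α α′ e β → let eu , ew = FP.combine-injective (tep k d (leftPart α)) _ (tep k d (leftPart α′)) _ e in via none all p α α′ β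
      (cong₂ (λ u w → matrixPart β (combine u w)) eu (determines _ _ ew (rightPart β)))

  -- The left value `u` is known and selects row `u` of the root matrix, so no entry of `p` outside
  -- that row can be read. The code may thus spend a different number of values on each `u`.
  Code-rows : ∀ {p} (rowCode : Fin k → (Fin (k * k) → Fin k) → Fin N) →
    (∀ u u′ x x′ → rowCode u x ≡ rowCode u′ x′ →
       u ≡ u′ × (∀ w → p (combine u w) ≡ true → x (combine u w) ≡ x′ (combine u w))) →
    Code (tep k (suc d)) (node p all none) N
  Code-rows {p = p} rowCode determines = code
    (λ α → rowCode (tep k d (leftPart α)) (matrixPart α))
    λ α α′ e β → via p all none α α′ β (same α α′ β (determines _ _ _ _ e))
    where
    same : ∀ α α′ β → let u = tep k d (leftPart α) ; u′ = tep k d (leftPart α′)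
                          w = tep k d (rightPart β) in
      (u ≡ u′ × ∀ w → p (combine u w) ≡ true → matrixPart α (combine u w) ≡ matrixPart α′ (combine u w)) →
      mix p (matrixPart α) (matrixPart β) (combine u w) ≡ mix p (matrixPart α′) (matrixPart β) (combine u′ w)
    same α α′ β (eu , agree) = trans
      (mix-agree {p = p} {matrixPart α} {matrixPart α′} {matrixPart β} _ (agree w))
      (cong (λ u → mix p (matrixPart α′) (matrixPart β) (combine u w)) eu)
      where w = tep k d (rightPart β)

  -- Once both subtrees are known, the row is a constant or a projection to a matrix entry outside p.
  Code-both : ∀ p → Code (tep k (suc d)) (node p all all) (k + count (not ∘ p))
  Code-both p = code
    (λ α → join k _ (summary (entry α) (matrixPart α) (p (entry α)) refl))
    λ α α′ e β → via p all all α α′ β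
      (same α α′ β _ refl _ refl (trans (sym (FP.splitAt-join k _ _)) (trans (cong (splitAt k) e) (FP.splitAt-join k _ _))))
    where
    entry : (Fin (sz k (suc d)) → Fin k) → Fin (k * k)
    entry α = combine (tep k d (leftPart α)) (tep k d (rightPart α))
    summary : ∀ i → (Fin (k * k) → Fin k) → ∀ b → p i ≡ b → Fin k ⊎ Fin (count (not ∘ p))
    summary i x true  _ = inj₁ (x i)
    summary i x false e = inj₂ (proj₁ (rank (not ∘ p)) i (cong not e))
    inside : ∀ α β → p (entry α) ≡ true →
             mix p (matrixPart α) (matrixPart β) (entry α) ≡ matrixPart α (entry α)
    inside α β = mix-in {p = p} {matrixPart α} {matrixPart β}
    outside : ∀ α β → p (entry α) ≡ false →
              mix p (matrixPart α) (matrixPart β) (entry α) ≡ matrixPart β (entry α)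
    outside α β = mix-out {p = p} {matrixPart α} {matrixPart β}
    same : ∀ α α′ β b e b′ e′ →
      summary (entry α) (matrixPart α) b e ≡ summary (entry α′) (matrixPart α′) b′ e′ →
      mix p (matrixPart α) (matrixPart β) (entry α) ≡ mix p (matrixPart α′) (matrixPart β) (entry α′)
    same α α′ β true e true e′ eq = trans (inside α β e) (trans (inj₁-injective eq) (sym (inside α′ β e′)))
    same α α′ β false e false e′ eq = trans (outside α β e)
      (trans (cong (matrixPart β) (proj₂ (rank (not ∘ p)) _ _ (inj₂-injective eq))) (sym (outside α′ β e′)))
    same α α′ β true  e false e′ ()
    same α α′ β false e true  e′ ()

-- Cheap sets of variables of every size

record Upper (f : (Fin n → Fin κ) → Fin κ) (ℓ N : ℕ) : Set where
  constructor upper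
  field
    vars     : Fin n → Bool
    size     : count vars ≡ ℓ
    row-code : Code f vars N

Upper-mono : ∀ {f : (Fin n → Fin κ) → Fin κ} {ℓ M} → M ≤ N → Upper f ℓ M → Upper f ℓ N
Upper-mono le (upper p c e) = upper p c (Code-mono le e)

Upper⇒Sℓ≤ : ∀ {f : (Fin n → Fin κ) → Fin κ} {ℓ} → Extensional f → Upper f ℓ N → Sℓ f ℓ ≤ N
Upper⇒Sℓ≤ {N = N} {f} f-ext (upper p refl e) =
  subst (λ ℓ → Sℓ f ℓ ≤ N) (∣tabulate∣ p) (Sℓ-≤ f (tabulate p) (nrows-≤ f-ext e))

private
  ≤-from-≡ : ∀ {a b} r → b ≡ a + r → a ≤ b
  ≤-from-≡ {a} r refl = m≤m+n a r

module _ (k d : ℕ) where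

  Upper-left : ∀ {ℓ} → Upper (tep k d) ℓ N → Upper (tep k (suc d)) ℓ N
  Upper-left (upper p refl e) = upper
    (node k d none p none)
    (trans (count-node k d none p none)
      (trans (cong₂ (λ a b → a + (count p + b)) (count-none {k * k}) (count-none {sz k d})) (+-identityʳ _)))
    (Code-left k d e)

  Upper-right : ∀ {ℓ} → Upper (tep k d) ℓ N → Upper (tep k (suc d)) (sz k d + ℓ) (k * N)
  Upper-right (upper p refl e) = upper
    (node k d none all p)
    (trans (count-node k d none all p)
      (cong₂ (λ a b → a + (b + count p)) (count-none {k * k}) (count-all {sz k d})))
    (Code-right k d e)

  Upper-both : ∀ {ℓ} → ℓ ≤ k * k → Upper (tep k (suc d)) (sz k d + sz k d + ℓ) (k + (k * k ∸ ℓ))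
  Upper-both {ℓ} ℓ≤ = let p , c = thinAll ℓ≤ in upper
    (node k d p all all)
    (trans (count-node k d p all all)
      (trans (cong₂ (λ a b → a + (b + b)) c (count-all {sz k d})) (+-comm ℓ _)))
    (subst (Code _ _) (cong (k +_) (complement p c)) (Code-both k d p))
    where
    complement : ∀ p → count p ≡ ℓ → count (not ∘ p) ≡ k * k ∸ ℓ
    complement p c = trans (sym (m+n∸m≡n ℓ _)) (cong (_∸ ℓ) (trans (cong (_+ count (not ∘ p)) (sym c)) (count-not p)))

-- All chosen entries lie in the first column, so the left value and one entry of its row form a
-- code.
Upper-one-per-row : ∀ k d {ℓ} → 1 ≤ k → ℓ ≤ k → Upper (tep k (suc d)) (sz k d + ℓ) (k * k)
Upper-one-per-row (suc k′) d {ℓ} _ ℓ≤k = upper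
  (node k d p all none)
  (trans (count-node k d p all none)
    (trans (cong₂ (λ a b → a + (b + count {sz k d} none)) c (count-all {sz k d}))
      (trans (cong (λ e → ℓ + (sz k d + e)) (count-none {sz k d}))
        (trans (cong (ℓ +_) (+-identityʳ _)) (+-comm ℓ _)))))
  -- The entry in column `zero` is recorded even where thinning has removed it from `p`, which a
  -- code is free to do.
  (Code-rows k d (λ u x → combine u (x (combine u zero)))
    λ u u′ x x′ e → let eu , ex = FP.combine-injective u _ u′ _ e in
      eu , λ w pw → read u w x x′ (trans ex (cong (λ u → x′ (combine u zero)) (sym eu)))
                      (trans (sym (cong (λ z → first (proj₂ z)) (FP.remQuot-combine u w))) (p⊆ _ pw)))
  where
  k = suc k′
  first : Fin k → Bool
  first zero    = true
  first (suc _) = false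
  column = λ i → first (proj₂ (remQuot {k} k i))
  thinned = thin column (≤-trans (subst (ℓ ≤_) (sym (count-all {k})) ℓ≤k)
    (count-≤-embedding {k} all column (λ u → combine u zero)
      (λ {i} {j} e → FP.combine-injectiveˡ i zero j zero e)
      λ u _ → cong (first ∘ proj₂) (FP.remQuot-combine u zero)))
  p = proj₁ thinned
  p⊆ = proj₁ (proj₂ thinned)
  c = proj₂ (proj₂ thinned)
  read : ∀ u w (x x′ : Fin (k * k) → Fin k) → x (combine u zero) ≡ x′ (combine u zero) → first w ≡ true →
         x (combine u w) ≡ x′ (combine u w)
  read u zero x x′ e _ = e

-- The first two columns are used, except for the second entry of the first row. That row costs `k`
-- codes and each other row `k²`; sparing the one entry keeps the total below `k³`.
Upper-two-per-row : ∀ k d {ℓ} → 2 ≤ k → ℓ ≤ k + (k ∸ 1) →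
                    Upper (tep k (suc d)) (sz k d + ℓ) (k + (k ∸ 1) * (k * k))
Upper-two-per-row (suc (suc k″)) d {ℓ} (s≤s (s≤s _)) ℓ≤ = upper
  (node k d p all none)
  (trans (count-node k d p all none)
    (trans (cong₂ (λ a b → a + (b + count {sz k d} none)) c (count-all {sz k d}))
      (trans (cong (λ e → ℓ + (sz k d + e)) (count-none {sz k d}))
        (trans (cong (ℓ +_) (+-identityʳ _)) (+-comm ℓ _)))))
  (Code-rows k d (λ u x → join k _ (summary u x)) λ u u′ x x′ e →
    let eu , agree = summary-determines u u′ x x′
          (trans (sym (FP.splitAt-join k _ (summary u x)))
            (trans (cong (splitAt k) e) (FP.splitAt-join k _ (summary u′ x′)))) in
    eu , λ w pw → agree w (trans (sym (cong (uncurry chosen) (FP.remQuot-combine u w))) (p⊆ _ pw)))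
  where
  k′ = suc k″
  k = suc k′
  chosen : Fin k → Fin k → Bool
  chosen u       zero          = true
  chosen (suc _) (suc zero)    = true
  chosen zero    (suc zero)    = false
  chosen u       (suc (suc _)) = false
  cells = λ i → uncurry chosen (remQuot {k} k i)
  place : Fin k ⊎ Fin k′ → Fin (k * k)
  place (inj₁ u) = combine {k} {k} u zero
  place (inj₂ u) = combine (suc u) (suc zero)
  place-injective : ∀ {s t} → place s ≡ place t → s ≡ t
  place-injective {inj₁ u} {inj₁ v} e = cong inj₁ (FP.combine-injectiveˡ u zero v zero e)
  place-injective {inj₂ u} {inj₂ v} e =
    cong inj₂ (FP.suc-injective (FP.combine-injectiveˡ (suc u) (suc zero) (suc v) (suc zero) e))
  place-injective {inj₁ u} {inj₂ v} e with () ← FP.combine-injectiveʳ u zero (suc v) (suc zero) e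
  place-injective {inj₂ u} {inj₁ v} e with () ← FP.combine-injectiveʳ (suc u) (suc zero) v zero e
  splitAt-injective : ∀ {i j : Fin (k + k′)} → splitAt k i ≡ splitAt k j → i ≡ j
  splitAt-injective {i} {j} e =
    trans (sym (FP.join-splitAt k k′ i)) (trans (cong (join k k′) e) (FP.join-splitAt k k′ j))
  placed : ∀ s → cells (place s) ≡ true
  placed (inj₁ u) = cong (uncurry chosen) (FP.remQuot-combine u zero)
  placed (inj₂ u) = cong (uncurry chosen) (FP.remQuot-combine (suc u) (suc zero))
  thinned = thin cells (≤-trans (subst (ℓ ≤_) (sym (count-all {k + k′})) ℓ≤)
    (count-≤-embedding {k + k′} all cells (place ∘ splitAt k) (splitAt-injective ∘ place-injective)
      λ i _ → placed (splitAt k i)))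
  p = proj₁ thinned
  p⊆ = proj₁ (proj₂ thinned)
  c = proj₂ (proj₂ thinned)
  summary : Fin k → (Fin (k * k) → Fin k) → Fin k ⊎ Fin (k′ * (k * k))
  summary zero    x = inj₁ (x (combine {k} {k} zero zero))
  summary (suc u) x = inj₂ (combine u (combine (x (combine {k} {k} (suc u) zero)) (x (combine (suc u) (suc zero)))))
  summary-determines : ∀ u u′ x x′ → summary u x ≡ summary u′ x′ →
    u ≡ u′ × (∀ w → chosen u w ≡ true → x (combine u w) ≡ x′ (combine u w))
  summary-determines zero zero x x′ e = refl , λ { zero _ → inj₁-injective e ; (suc zero) () ; (suc (suc _)) () }
  summary-determines zero (suc u′) x x′ ()
  summary-determines (suc u) zero x x′ ()
  summary-determines (suc u) (suc u′) x x′ e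
    with refl , e′ ← FP.combine-injective u _ u′ _ (inj₂-injective e)
    with e₀ , e₁ ← FP.combine-injective _ _ _ _ e′ =
    refl , λ { zero _ → e₀ ; (suc zero) _ → e₁ ; (suc (suc _)) () }

m≤n⇒∃ : ∀ {m n} → m ≤ n → ∃ λ r → n ≡ m + r
m≤n⇒∃ {m} {n} le = n ∸ m , sym (m+[n∸m]≡n le)

k≤k² : ∀ k → k ≤ k * k
k≤k² zero    = z≤n
k≤k² (suc k) = m≤m+n (suc k) _

-- Up to `k + 1` variables fit into one leaf and one entry per row. With more, both leaves and at
-- least `k` entries are taken, leaving `k` constants and at most `k² − k` projections.
Upper-height2 : ∀ k ℓ → 1 ≤ k → suc ℓ ≤ sz k 1 → Upper (tep k 1) (suc ℓ) (k * k)
Upper-height2 k ℓ 1≤k ℓ< with ℓ ≤? k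
... | yes ℓ≤k = Upper-one-per-row k 0 1≤k ℓ≤k
... | no ℓ≰k with r , refl ← m≤n⇒∃ (≰⇒> ℓ≰k) =
    Upper-mono
      (begin
        k + (k * k ∸ (k + r)) ≤⟨ +-monoʳ-≤ k (∸-monoʳ-≤ (k * k) (m≤m+n k r)) ⟩
        k + (k * k ∸ k)       ≡⟨ m+[n∸m]≡n (k≤k² k) ⟩
        k * k ∎)
      (Upper-both k 0 (s≤s⁻¹ (s≤s⁻¹ (subst (2 + (k + r) ≤_) (+-comm (k * k) 2) ℓ<))))
  where
  open ≤-Reasoning

private
  -- For `k ≥ 2` this is `k² − k + 2`, the cost allowed per value of the left subtree at height 3.
  -- Multiplied by `k^(h−2)` it becomes the claimed bound at height `h`.
  bound : ℕ → ℕ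
  bound k = k * k ∸ (k ∸ 2)

  bound≡ : ∀ j → bound (2 + j) ≡ 4 + 3 * j + j * j
  bound≡ j = trans (cong (_∸ j) (eq j)) (m+n∸n≡m _ j)
    where
    eq : ∀ j → (2 + j) * (2 + j) ≡ (4 + 3 * j + j * j) + j
    eq = solve-∀

  k≤bound : ∀ k → 2 ≤ k → k ≤ bound k
  k≤bound (suc (suc j)) (s≤s (s≤s _)) = subst (2 + j ≤_) (sym (bound≡ j)) (≤-from-≡ _ (eq j))
    where
    eq : ∀ j → 4 + 3 * j + j * j ≡ 2 + j + (2 + 2 * j + j * j)
    eq = solve-∀

  two-per-row≤bound : ∀ k → 2 ≤ k → k + (k ∸ 1) * (k * k) ≤ k * bound k
  two-per-row≤bound (suc (suc j)) (s≤s (s≤s _)) =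
    subst (λ g → 2 + j + suc j * ((2 + j) * (2 + j)) ≤ (2 + j) * g) (sym (bound≡ j)) (≤-from-≡ _ (eq j))
    where
    eq : ∀ j → (2 + j) * (4 + 3 * j + j * j) ≡ 2 + j + suc j * ((2 + j) * (2 + j)) + (2 + j)
    eq = solve-∀

  k+k²≤k*bound : ∀ k → 2 ≤ k → k + k * k ≤ k * bound k
  k+k²≤k*bound (suc (suc j)) (s≤s (s≤s _)) =
    subst (λ g → 2 + j + (2 + j) * (2 + j) ≤ (2 + j) * g) (sym (bound≡ j)) (≤-from-≡ _ (eq j))
    where
    eq : ∀ j → (2 + j) * (4 + 3 * j + j * j) ≡ 2 + j + (2 + j) * (2 + j) + (2 + j) * (1 + 2 * j + j * j)
    eq = solve-∀

  -- This fixes the value of `bound`: both leaves and `m = 2k − 2` entries at height 2 cost exactly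
  -- `k + k² − (2k − 2)`.
  k+[k²∸m]≤bound : ∀ k m → 2 ≤ k → k + k ≤ 2 + m → k + (k * k ∸ m) ≤ bound k
  k+[k²∸m]≤bound (suc (suc j)) m (s≤s (s≤s _)) 2k≤ = begin
    2 + j + ((2 + j) * (2 + j) ∸ m)
      ≤⟨ +-monoʳ-≤ (2 + j) (∸-monoʳ-≤ ((2 + j) * (2 + j)) 2j+2≤m) ⟩
    2 + j + ((2 + j) * (2 + j) ∸ (j + (2 + j)))
      ≡⟨ cong (2 + j +_) (trans (cong (_∸ (j + (2 + j))) (eq₁ j)) (m+n∸n≡m _ (j + (2 + j)))) ⟩
    2 + j + (2 + 2 * j + j * j)
      ≡⟨ eq₂ j ⟩
    4 + 3 * j + j * j
      ≡⟨ bound≡ j ⟨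
    bound (2 + j) ∎
    where
    open ≤-Reasoning
    2j+2≤m : j + (2 + j) ≤ m
    2j+2≤m = s≤s⁻¹ (s≤s⁻¹ 2k≤)
    eq₁ : ∀ j → (2 + j) * (2 + j) ≡ (2 + 2 * j + j * j) + (j + (2 + j))
    eq₁ = solve-∀
    eq₂ : ∀ j → 2 + j + (2 + 2 * j + j * j) ≡ 4 + 3 * j + j * j
    eq₂ = solve-∀

-- Which subtrees are exhausted when the variables are taken from left to right, matrix last.
split-budget : ∀ {M} s ℓ → suc ℓ ≤ M + (s + s) →
  suc ℓ ≤ s ⊎ (∃ λ r → suc ℓ ≡ s + suc r × suc r ≤ s) ⊎ (∃ λ t → suc ℓ ≡ s + s + t × t ≤ M)
split-budget {M} s ℓ ℓ< with suc ℓ ≤? s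
... | yes ℓ≤ = inj₁ ℓ≤
... | no ℓ≰ with r , e ← m≤n⇒∃ (s≤s⁻¹ (≰⇒> ℓ≰)) with suc r ≤? s
...   | yes r≤ = inj₂ (inj₁ (r , trans (cong suc e) (sym (+-suc s r)) , r≤))
...   | no r≰ with t , e₂ ← m≤n⇒∃ (<⇒≤ (≰⇒> r≰)) =
  inj₂ (inj₂ (t , total , +-cancelˡ-≤ (s + s) t M (subst₂ _≤_ total (+-comm M (s + s)) ℓ<)))
  where
  total : suc ℓ ≡ s + s + t
  total = trans (cong suc e) (trans (sym (+-suc s r)) (trans (cong (s +_) e₂) (sym (+-assoc s s t))))

module _ (k : ℕ) (2≤k : 2 ≤ k) where

  Upper-height3 : ∀ ℓ → suc ℓ ≤ sz k 2 → Upper (tep k 2) (suc ℓ) (k * bound k)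
  Upper-height3 ℓ ℓ< with split-budget {k * k} (sz k 1) ℓ ℓ<
  ... | inj₁ ℓ≤ = Upper-mono (*-monoʳ-≤ k (k≤bound k 2≤k))
    (Upper-left k 1 (Upper-height2 k ℓ (<⇒≤ 2≤k) ℓ≤))
  ... | inj₂ (inj₂ (t , e , t≤)) = subst (λ ℓ → Upper (tep k 2) ℓ (k * bound k)) (sym e)
    (Upper-mono (≤-trans (+-monoʳ-≤ k (m∸n≤m (k * k) t)) (k+k²≤k*bound k 2≤k)) (Upper-both k 1 t≤))
  ... | inj₂ (inj₁ (r , e , r≤)) = subst (λ ℓ → Upper (tep k 2) ℓ (k * bound k)) (sym e) beyond
    where
    -- The left subtree is exhausted and `suc r` variables remain. Up to `2k − 1` of them come from
    -- the root matrix. A larger number comes from the right subtree: its two leaves and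
    -- `m ≥ 2k − 2` entries.
    beyond : Upper (tep k 2) (sz k 1 + suc r) (k * bound k)
    beyond with suc r ≤? k + (k ∸ 1)
    ... | yes r≤′ = Upper-mono (two-per-row≤bound k 2≤k) (Upper-two-per-row k 1 2≤k r≤′)
    ... | no r≰ with m , e′ ← m≤n⇒∃ {2} (≤-trans 2≤k (≤-trans (m≤m+n k _) (<⇒≤ (≰⇒> r≰)))) =
      Upper-right k 1 (subst (λ r → Upper (tep k 1) r (bound k)) (sym e′)
        (Upper-mono
          (k+[k²∸m]≤bound k m 2≤k (subst₂ _≤_ k+suc e′ (≰⇒> r≰)))
          (Upper-both k 0 (+-cancelˡ-≤ 2 m (k * k) (subst₂ _≤_ e′ (+-comm (k * k) 2) r≤)))))
      where
      k+suc : suc (k + (k ∸ 1)) ≡ k + k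
      k+suc = trans (sym (+-suc k (k ∸ 1))) (cong (k +_) (m+[n∸m]≡n (<⇒≤ 2≤k)))

  private
    bound-mono : ∀ d → k ^ suc d * bound k ≤ k ^ suc (suc d) * bound k
    bound-mono d = *-monoˡ-≤ (bound k) (^-monoʳ-≤ k ⦃ >-nonZero (<⇒≤ 2≤k) ⦄ (n≤1+n (suc d)))

    k+k²≤ : ∀ d → k + k * k ≤ k ^ suc d * bound k
    k+k²≤ zero    = subst (λ k′ → k + k * k ≤ k′ * bound k) (sym (*-identityʳ k)) (k+k²≤k*bound k 2≤k)
    k+k²≤ (suc d) = ≤-trans (k+k²≤ d) (bound-mono d)

  -- By induction on the height: exhausting the left subtree costs a factor `k`, staying inside it
  -- costs nothing more, and exhausting both subtrees leaves at most `k + k²` rows.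
  Upper-height≥3 : ∀ d ℓ → suc ℓ ≤ sz k (2 + d) → Upper (tep k (2 + d)) (suc ℓ) (k ^ suc d * bound k)
  Upper-height≥3 zero ℓ ℓ< = subst (λ k′ → Upper (tep k 2) (suc ℓ) (k′ * bound k)) (sym (*-identityʳ k))
    (Upper-height3 ℓ ℓ<)
  Upper-height≥3 (suc d) ℓ ℓ< with split-budget {k * k} (sz k (2 + d)) ℓ ℓ<
  ... | inj₁ ℓ≤ = Upper-mono (bound-mono d) (Upper-left k (2 + d) (Upper-height≥3 d ℓ ℓ≤))
  ... | inj₂ (inj₁ (r , e , r≤)) = subst₂ (Upper (tep k (3 + d))) (sym e) (sym (*-assoc k (k ^ suc d) (bound k)))
    (Upper-right k (2 + d) (Upper-height≥3 d r r≤))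
  ... | inj₂ (inj₂ (t , e , t≤)) = subst (λ ℓ → Upper (tep k (3 + d)) ℓ (k ^ suc (suc d) * bound k)) (sym e)
    (Upper-mono (≤-trans (+-monoʳ-≤ k (m∸n≤m (k * k) t)) (k+k²≤ (suc d))) (Upper-both k (2 + d) t≤))

Smax-height2≤ : ∀ k → 2 ≤ k → Smax (TEP k 2) ≤ k * k
Smax-height2≤ k 2≤k = Smax-≤ (tep k 1) λ ℓ ℓ< →
  Upper⇒Sℓ≤ (tep-ext k 1) (Upper-height2 k ℓ (<⇒≤ 2≤k) ℓ<)

Smax-height≥3≤ : ∀ k → 2 ≤ k → ∀ d → Smax (TEP k (3 + d)) ≤ k ^ (3 + d) ∸ k ^ (1 + d) * (k ∸ 2)
Smax-height≥3≤ k 2≤k d = subst (Smax (TEP k (3 + d)) ≤_)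
  (trans (*-distribˡ-∸ (k ^ suc d) (k * k) (k ∸ 2)) (cong (_∸ k ^ suc d * (k ∸ 2)) power))
  (Smax-≤ (tep k (2 + d)) λ ℓ ℓ< → Upper⇒Sℓ≤ (tep-ext k (2 + d)) (Upper-height≥3 k 2≤k d ℓ ℓ<))
  where
  power : k ^ suc d * (k * k) ≡ k ^ (3 + d)
  power = trans (*-comm (k ^ suc d) (k * k)) (*-assoc k k (k ^ suc d))

-- Lower bounds

remQuot-injective : ∀ {a} b {i j : Fin (a * b)} → remQuot {a} b i ≡ remQuot b j → i ≡ j
remQuot-injective {a} b {i} {j} e =
  trans (sym (FP.combine-remQuot {a} b i)) (trans (cong (uncurry combine) e) (FP.combine-remQuot {a} b j))

count₂ : (Fin κ → Fin κ → Bool) → ℕ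
count₂ {κ} p = count (uncurry p ∘ remQuot {κ} κ)

module _ (p : Fin κ → Fin κ → Bool) where

  count₂-not : count₂ p + count₂ (λ a b → not (p a b)) ≡ κ * κ
  count₂-not = count-not (uncurry p ∘ remQuot {κ} κ)

  count₂≤ : count₂ p ≤ κ * κ
  count₂≤ = subst (count₂ p ≤_) count₂-not (m≤m+n _ _)

  enumerate₂ : Σ (Fin (count₂ p) → Fin κ × Fin κ) λ h →
               (∀ i → uncurry p (h i) ≡ true) × (∀ {i j} → h i ≡ h j → i ≡ j)
  enumerate₂ = let h , holds , inj = enumerate (uncurry p ∘ remQuot {κ} κ) in
    remQuot κ ∘ h , holds , inj ∘ remQuot-injective κ

  rank₂ : Σ (∀ a b → p a b ≡ true → Fin (count₂ p)) λ r →
          ∀ {a b a′ b′} (e : p a b ≡ true) (e′ : p a′ b′ ≡ true) → r a b e ≡ r a′ b′ e′ → (a , b) ≡ (a′ , b′)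
  rank₂ =
    (λ a b e → r (combine a b) (at a b e)) ,
    λ {a} {b} {a′} {b′} e e′ eq →
      let ea , eb = FP.combine-injective a b a′ b′ (inj (at a b e) (at a′ b′ e′) eq) in cong₂ _,_ ea eb
    where
    r = proj₁ (rank (uncurry p ∘ remQuot {κ} κ))
    inj = proj₂ (rank (uncurry p ∘ remQuot {κ} κ))
    at : ∀ a b → p a b ≡ true → uncurry p (remQuot {κ} κ (combine a b)) ≡ true
    at a b = trans (cong (uncurry p) (FP.remQuot-combine a b))

  row-fibres : ∀ s →
    (Σ (Fin κ) λ u → Σ (Fin (suc s) → Fin κ) λ w → (∀ {i j} → w i ≡ w j → i ≡ j) × (∀ i → p u (w i) ≡ true))
    ⊎ count₂ p ≤ s * κ
  row-fibres s with count-fibres {s = s} (uncurry p ∘ remQuot {κ} κ) (proj₁ ∘ remQuot {κ} κ)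
  ... | inj₂ le = inj₂ le
  ... | inj₁ (u , h , inj , holds) = inj₁
    (u , proj₂ ∘ remQuot {κ} κ ∘ h ,
     (λ {i} {j} e → inj (remQuot-injective κ (cong₂ _,_ (trans (proj₂ (holds i)) (sym (proj₂ (holds j)))) e))) ,
     λ i → subst (λ u → p u _ ≡ true) (proj₂ (holds i)) (proj₁ (holds i)))

count₂-flip : (p : Fin κ → Fin κ → Bool) → count₂ (flip p) ≡ count₂ p
count₂-flip p = ≤-antisym (half p) (half (flip p))
  where
  half : (p : Fin κ → Fin κ → Bool) → count₂ (flip p) ≤ count₂ p
  half {κ} p = let h , holds , inj = enumerate₂ (flip p)
                   r , r-inj = rank₂ p
               in FP.injective⇒≤ {f = λ i → r (proj₂ (h i)) (proj₁ (h i)) (holds i)}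
                    (inj ∘ cong swap ∘ r-inj _ _)

-- Interpolation: for injective `h`, a map with prescribed values at the points `h i`. It stores a
-- vector `v` in selected matrix entries.
search : {X : Set} → DecidableEquality X → (Fin m → X) → (Fin m → Fin κ) → Fin κ → X → Fin κ
search _≟ˣ_ h v default x with FP.any? (λ i → h i ≟ˣ x)
... | yes (i , _) = v i
... | no _        = default

search-hit : {X : Set} (_≟ˣ_ : DecidableEquality X) (h : Fin m → X) (v : Fin m → Fin κ) (default : Fin κ) →
             (∀ {i j} → h i ≡ h j → i ≡ j) → ∀ i → search _≟ˣ_ h v default (h i) ≡ v i
search-hit _≟ˣ_ h v default inj i with FP.any? (λ j → h j ≟ˣ h i)
... | yes (j , e) = cong v (inj e)
... | no none     = contradiction (i , refl) none

_≟²_ : DecidableEquality (Fin κ × Fin κ)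
_≟²_ = ≡-dec FP._≟_ FP._≟_

-- A matrix with one exceptional entry. Used in `β`, it detects which entry an assignment leads to.
spot : Fin κ × Fin κ → Fin κ → Fin κ → Fin κ → Fin κ → Fin κ
spot c x y u w with (u , w) ≟² c
... | yes _ = x
... | no _  = y

spot-hit : ∀ (c : Fin κ × Fin κ) {x y} → uncurry (spot c x y) c ≡ x
spot-hit c with c ≟² c
... | yes _ = refl
... | no ne = contradiction refl ne

spot-miss : ∀ {c} {x y u w : Fin κ} → (u , w) ≢ c → spot c x y u w ≡ y
spot-miss {c = c} {u = u} {w} ne with (u , w) ≟² c
... | yes e = contradiction e ne
... | no _  = refl

funToFin-cong : {g h : Fin m → Fin κ} → g ≗ h → funToFin g ≡ funToFin h
funToFin-cong {zero}  e = refl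
funToFin-cong {suc m} e = cong₂ combine (e zero) (funToFin-cong (e ∘ suc))

-- If column `β i` reads off the coordinate `v i`, the row of `α v` determines `v`, so the `κ^t`
-- vectors have distinct rows.
^-≤-nrows : {f : (Fin n → Fin κ) → Fin κ} → Extensional f → ∀ A t
  (α : (Fin t → Fin κ) → Fin n → Fin κ) (β : Fin t → Fin n → Fin κ) →
  (∀ v i → f (merge A (α v) (β i)) ≡ v i) → κ ^ t ≤ nrows f A
^-≤-nrows {n} {κ} f-ext A t α β reads = ≤-nrows f-ext id id A (α ∘ finToFun) λ x y same →
  trans (sym (FP.funToFin-finToFin {t} {κ} x))
    (trans (funToFin-cong (λ i → trans (sym (reads _ i)) (trans (same (β i)) (reads _ i))))
      (FP.funToFin-finToFin {t} {κ} y))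

-- Trees of height 2

-- An interface that hides the layout of the variables, so that `transpose₂` can exchange the two
-- leaves. `asg` assembles an assignment from a matrix and two labels.
record Tree₂ (f : (Fin n → Fin κ) → Fin κ) : Set where
  field
    M      : Fin κ → Fin κ → Fin n
    la lb  : Fin n
    eval   : ∀ z → f z ≡ z (M (z la) (z lb))
    asg    : (Fin κ → Fin κ → Fin κ) → Fin κ → Fin κ → Fin n → Fin κ
    asg-M  : ∀ {m a b} u w → asg m a b (M u w) ≡ m u w
    asg-la : ∀ {m a b} → asg m a b la ≡ a
    asg-lb : ∀ {m a b} → asg m a b lb ≡ b
    size   : ∀ (p : Fin n → Bool) → count p ≡ count₂ (λ u w → p (M u w)) + (bit (p la) + bit (p lb))

  eval-at : ∀ z {a b} → z la ≡ a → z lb ≡ b → f z ≡ z (M a b)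
  eval-at z refl refl = eval z

transpose₂ : {f : (Fin n → Fin κ) → Fin κ} → Tree₂ f → Tree₂ f
transpose₂ T = record
  { M = flip M ; la = lb ; lb = la ; eval = eval
  ; asg = λ m a b → asg (flip m) b a
  ; asg-M = λ u w → asg-M w u ; asg-la = asg-lb ; asg-lb = asg-la
  ; size = λ p → trans (size p)
      (cong₂ _+_ (sym (count₂-flip (λ u w → p (M u w)))) (+-comm (bit (p la)) _))
  }
  where open Tree₂ T

module Height2 {f : (Fin n → Fin κ) → Fin κ} (f-ext : Extensional f) (A : Subset n)
               (o : Fin κ) (fresh : Fin κ → Fin κ) (fresh≢ : ∀ x → fresh x ≢ x) where

  private
    p = lookup A

  module _ (T : Tree₂ f) where
    open Tree₂ T

    -- The `t` entries in `A` store an arbitrary vector, and the columns visit them one by one. A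
    -- leaf in `A` cannot move, so the entries must then agree in its coordinate.
    sweep : ∀ {t} (a b : Fin t → Fin κ) → (∀ {i j} → (a i , b i) ≡ (a j , b j) → i ≡ j) →
            (∀ i → p (M (a i) (b i)) ≡ true) →
            (a₀ b₀ : Fin κ) → p la ≡ false ⊎ (∀ i → a i ≡ a₀) → p lb ≡ false ⊎ (∀ i → b i ≡ b₀) →
            κ ^ t ≤ nrows f A
    sweep {t} a b inj inA a₀ b₀ at-a at-b = ^-≤-nrows f-ext A t α β λ v i →
      trans (eval-at (merge A (α v) (β i)) (read-a v i at-a) (read-b v i at-b))
        (trans (mix-in {p = p} {α v} {β i} (inA i))
          (trans (asg-M (a i) (b i)) (search-hit _≟²_ (λ i → a i , b i) v o inj i)))
      where
      α : (Fin t → Fin κ) → Fin n → Fin κ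
      α v = asg (λ u w → search _≟²_ (λ i → a i , b i) v o (u , w)) a₀ b₀
      β : Fin t → Fin n → Fin κ
      β i = asg (λ _ _ → o) (a i) (b i)
      read-a : ∀ v i → p la ≡ false ⊎ (∀ i → a i ≡ a₀) → merge A (α v) (β i) la ≡ a i
      read-a v i (inj₁ out) = trans (mix-out {p = p} {α v} {β i} out) asg-la
      read-a v i (inj₂ e)   = mix-same {p = p} {α v} {β i} (trans asg-la (sym (e i))) asg-la
      read-b : ∀ v i → p lb ≡ false ⊎ (∀ i → b i ≡ b₀) → merge A (α v) (β i) lb ≡ b i
      read-b v i (inj₁ out) = trans (mix-out {p = p} {α v} {β i} out) asg-lb
      read-b v i (inj₂ e)   = mix-same {p = p} {α v} {β i} (trans asg-lb (sym (e i))) asg-lb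

    -- With both leaves in A, an entry outside A yields a projection; the at most κ entries inside A
    -- are matched with distinct constants, all read off the single entry (a₀ , b₀).
    both-leaves : p la ≡ true → p lb ≡ true → ∀ a₀ b₀ → p (M a₀ b₀) ≡ true →
                  count₂ (λ u w → p (M u w)) ≤ κ → κ * κ ≤ nrows f A
    both-leaves in-a in-b a₀ b₀ in-M few =
      ≤-nrows f-ext (remQuot κ) (remQuot-injective κ) A (λ (a , b) → α a b _ refl)
        λ (a , b) (a′ , b′) → separated a b a′ b′ _ refl _ refl
      where
      constant : ∀ a b → p (M a b) ≡ true → Fin κ
      constant a b e = inject≤ (proj₁ (rank₂ (λ u w → p (M u w))) a b e) few
      α : ∀ a b c → p (M a b) ≡ c → Fin n → Fin κ
      α a b true  e = asg (λ _ _ → constant a b e) a₀ b₀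
      α a b false _ = asg (λ _ _ → o) a b
      value-in : ∀ a b e β → f (merge A (α a b true e) β) ≡ constant a b e
      value-in a b e β = trans
        (eval-at (merge A α′ β) (trans (mix-in {p = p} {α′} {β} in-a) asg-la) (trans (mix-in {p = p} {α′} {β} in-b) asg-lb))
        (trans (mix-in {p = p} {α′} {β} in-M) (asg-M a₀ b₀))
        where α′ = α a b true e
      value-out : ∀ a b e β → f (merge A (α a b false e) β) ≡ β (M a b)
      value-out a b e β = trans
        (eval-at (merge A α′ β) (trans (mix-in {p = p} {α′} {β} in-a) asg-la) (trans (mix-in {p = p} {α′} {β} in-b) asg-lb))
        (mix-out {p = p} {α′} {β} e)
        where α′ = α a b false e
      constantly : Fin κ → Fin n → Fin κ
      constantly v = asg (λ _ _ → v) o o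
      separated : ∀ a b a′ b′ c e c′ e′ →
        (∀ β → f (merge A (α a b c e) β) ≡ f (merge A (α a′ b′ c′ e′) β)) → (a , b) ≡ (a′ , b′)
      separated a b a′ b′ true e true e′ same = proj₂ (rank₂ (λ u w → p (M u w))) e e′
        (FP.inject≤-injective few few _ _
          (trans (sym (value-in a b e (constantly o))) (trans (same _) (value-in a′ b′ e′ _))))
      separated a b a′ b′ true e false e′ same = contradiction
        (trans (sym (asg-M a′ b′)) (trans (sym (value-out a′ b′ e′ β)) (trans (sym (same β)) (value-in a b e β))))
        (fresh≢ (constant a b e))
        where β = constantly (fresh (constant a b e))
      separated a b a′ b′ false e true e′ same = contradiction
        (trans (sym (asg-M a b)) (trans (sym (value-out a b e β)) (trans (same β) (value-in a′ b′ e′ β))))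
        (fresh≢ (constant a′ b′ e′))
        where β = constantly (fresh (constant a′ b′ e′))
      separated a b a′ b′ false e false e′ same with (a′ , b′) ≟² (a , b)
      ... | yes eq = sym eq
      ... | no ne = contradiction
        (trans (sym (spot-miss ne))
          (trans (sym (asg-M a′ b′)) (trans (sym (value-out a′ b′ e′ β))
            (trans (sym (same β)) (trans (value-out a b e β) (trans (asg-M a b) (spot-hit (a , b))))))))
        (fresh≢ o)
        where β = asg (spot (a , b) o (fresh o)) o o

    -- An assignment chooses an occupied row through `la` and a value for the single entry of `A` in
    -- it. The stored value is read there, and the row is recognised by an entry outside `A`.
    one-per-row : p la ≡ true → p lb ≡ false →
                  (∀ u w w′ → p (M u w) ≡ true → p (M u w′) ≡ true → w ≡ w′) →
                  count₂ (λ u w → p (M u w)) * κ ≤ nrows f A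
    one-per-row in-a out-b single =
      ≤-nrows f-ext (remQuot κ) (remQuot-injective κ) A (uncurry α) λ (i , v) (j , v′) → separated i v j v′
      where
      entry = proj₁ (enumerate₂ (λ u w → p (M u w)))
      entry∈ = proj₁ (proj₂ (enumerate₂ (λ u w → p (M u w))))
      entry-inj = proj₂ (proj₂ (enumerate₂ (λ u w → p (M u w))))
      α : Fin (count₂ (λ u w → p (M u w))) → Fin κ → Fin n → Fin κ
      α i v = asg (λ _ _ → v) (proj₁ (entry i)) o
      value : ∀ i v m b → f (merge A (α i v) (asg m o b)) ≡ merge A (α i v) (asg m o b) (M (proj₁ (entry i)) b)
      value i v m b = eval-at (merge A (α i v) (asg m o b))
        (trans (mix-in {p = p} {α i v} {asg m o b} in-a) asg-la)
        (trans (mix-out {p = p} {α i v} {asg m o b} out-b) asg-lb)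
      separated : ∀ i v j v′ → (∀ β → f (merge A (α i v) β) ≡ f (merge A (α j v′) β)) → (i , v) ≡ (j , v′)
      separated i v j v′ same with i FP.≟ j
      ... | yes refl = cong (i ,_)
        (trans (sym (asg-M (proj₁ (entry i)) b)) (trans (sym (mix-in {p = p} {α i v} {β} (entry∈ i)))
          (trans (sym (value i v _ b)) (trans (same β) (trans (value i v′ _ b)
            (trans (mix-in {p = p} {α i v′} {β} (entry∈ i)) (asg-M (proj₁ (entry i)) b)))))))
        where
        b = proj₂ (entry i)
        β = asg (λ _ _ → o) o b
      ... | no i≢j = contradiction
        (trans (sym (spot-hit (u , b))) (trans (sym (asg-M u b)) (trans (sym (mix-out {p = p} {α i v} {β} out))
          (trans (sym (value i v _ b)) (trans (same β) (trans (value j v′ _ b)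
            (mix-same {p = p} {α j v′} {β} (asg-M _ b) (trans (asg-M _ b) (spot-miss (u≢ ∘ sym ∘ cong proj₁))))))))))
        (fresh≢ v′)
        where
        u = proj₁ (entry i)
        b = fresh (proj₂ (entry i))
        -- Row `u` has only one entry in `A`, so `(u , b)` is controlled by `β`. Assignment `j`
        -- reads another row, where both `α` and `β` carry `v′`.
        β = asg (spot (u , b) (fresh v′) v′) o b
        out : p (M u b) ≡ false
        out with p (M u b) in eq
        ... | false = refl
        ... | true  = contradiction (single _ _ _ eq (entry∈ i)) (fresh≢ (proj₂ (entry i)))
        u≢ : u ≢ proj₁ (entry j)
        u≢ e = i≢j (entry-inj (cong₂ _,_ e (single u _ _ (entry∈ i)
                 (subst (λ u → p (M u (proj₂ (entry j))) ≡ true) (sym e) (entry∈ j)))))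

    -- Two entries of `A` in a common row are swept by the free leaf and give `κ²` rows. Otherwise
    -- the entries lie in distinct rows and each contributes `κ`.
    one-leaf : p la ≡ true → p lb ≡ false → κ ≤ count₂ (λ u w → p (M u w)) → κ * κ ≤ nrows f A
    one-leaf in-a out-b many with FP.any? (λ u → FP.any? λ w → FP.any? λ w′ →
        (p (M u w) ≟ᵇ true) ×-dec ((p (M u w′) ≟ᵇ true) ×-dec ¬? (w FP.≟ w′)))
    ... | no ¬repeated = ≤-trans (*-monoˡ-≤ κ many) (one-per-row in-a out-b λ u w w′ e e′ →
      case w FP.≟ w′ of λ { (yes eq) → eq ; (no ne) → contradiction (u , w , w′ , e , e′ , ne) ¬repeated })
    ... | yes (u , w , w′ , e , e′ , w≢w′) = subst (_≤ nrows f A) (cong (κ *_) (*-identityʳ κ))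
      (sweep {2} (λ _ → u) ws (ws-inj _ _ ∘ cong proj₂) (λ { zero → e ; (suc zero) → e′ })
        u o (inj₂ λ _ → refl) (inj₁ out-b))
      where
      ws : Fin 2 → Fin κ
      ws zero       = w
      ws (suc zero) = w′
      ws-inj : ∀ i j → ws i ≡ ws j → i ≡ j
      ws-inj zero       zero       _ = refl
      ws-inj (suc zero) (suc zero) _ = refl
      ws-inj zero       (suc zero) q = contradiction q w≢w′
      ws-inj (suc zero) zero       q = contradiction (sym q) w≢w′

    no-leaf : p la ≡ false → p lb ≡ false → 2 ≤ count₂ (λ u w → p (M u w)) → κ * κ ≤ nrows f A
    no-leaf out-a out-b many = subst (_≤ nrows f A) (cong (κ *_) (*-identityʳ κ))
      (sweep {2} (proj₁ ∘ entry ∘ emb) (proj₂ ∘ entry ∘ emb)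
        (λ e → FP.inject≤-injective many many _ _ (entry-inj e)) (entry∈ ∘ emb) o o (inj₁ out-a) (inj₁ out-b))
      where
      entry = proj₁ (enumerate₂ (λ u w → p (M u w)))
      entry∈ = proj₁ (proj₂ (enumerate₂ (λ u w → p (M u w))))
      entry-inj = proj₂ (proj₂ (enumerate₂ (λ u w → p (M u w))))
      emb : Fin 2 → Fin (count₂ (λ u w → p (M u w)))
      emb i = inject≤ i many

  -- With both leaves in `A`, between 1 and `κ` entries are in `A`; with one leaf, at least `κ`;
  -- with none, at least 2. These are the ranges the three cases ask for.
  κ²≤nrows : Tree₂ f → 2 ≤ κ → 1 + κ ≤ count p → count p ≤ 2 + κ → κ * κ ≤ nrows f A
  κ²≤nrows T 2≤κ low high = cases _ _ refl refl (size p)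
    where
    open Tree₂ T
    c = count₂ (λ u w → p (M u w))
    cases : ∀ x y → p la ≡ x → p lb ≡ y → count p ≡ c + (bit x + bit y) → κ * κ ≤ nrows f A
    cases true true ea eb total =
      let h , holds , _ = enumerate₂ (λ u w → p (M u w))
          i = fromℕ< (+-cancelʳ-≤ 2 1 c (≤-trans (s≤s 2≤κ) (subst (1 + κ ≤_) total low)))
      in both-leaves T ea eb _ _ (holds i) (+-cancelʳ-≤ 2 c κ (subst₂ _≤_ total (+-comm 2 κ) high))
    cases true false ea eb total = one-leaf T ea eb (+-cancelʳ-≤ 1 κ c (subst₂ _≤_ (+-comm 1 κ) total low))
    cases false true ea eb total =
      one-leaf (transpose₂ T) eb ea (subst (κ ≤_) (sym (count₂-flip (λ u w → p (M u w))))
        (+-cancelʳ-≤ 1 κ c (subst₂ _≤_ (+-comm 1 κ) total low)))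
    cases false false ea eb total =
      no-leaf T ea eb (≤-trans 2≤κ (≤-trans (n≤1+n κ) (subst (1 + κ ≤_) (trans total (+-identityʳ c)) low)))

-- Trees of height 3

-- The analogous interface at height 3. Its symmetries `mirror` and `transposeL` carry any leaf to
-- the position of `lb`.
record Tree₃ (f : (Fin n → Fin κ) → Fin κ) : Set where
  field
    R L Q       : Fin κ → Fin κ → Fin n
    la lb lc ld : Fin n
    eval   : ∀ z → f z ≡ z (R (z (L (z la) (z lb))) (z (Q (z lc) (z ld))))
    asg    : (r l q : Fin κ → Fin κ → Fin κ) (a b c d : Fin κ) → Fin n → Fin κ
    asg-R  : ∀ {r l q a b c d} u w → asg r l q a b c d (R u w) ≡ r u w
    asg-L  : ∀ {r l q a b c d} u w → asg r l q a b c d (L u w) ≡ l u w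
    asg-Q  : ∀ {r l q a b c d} u w → asg r l q a b c d (Q u w) ≡ q u w
    asg-la : ∀ {r l q a b c d} → asg r l q a b c d la ≡ a
    asg-lb : ∀ {r l q a b c d} → asg r l q a b c d lb ≡ b
    asg-lc : ∀ {r l q a b c d} → asg r l q a b c d lc ≡ c
    asg-ld : ∀ {r l q a b c d} → asg r l q a b c d ld ≡ d
    size   : ∀ (p : Fin n → Bool) → count p ≡ count₂ (λ u w → p (R u w)) +
               ((count₂ (λ u w → p (L u w)) + (bit (p la) + bit (p lb))) +
                (count₂ (λ u w → p (Q u w)) + (bit (p lc) + bit (p ld))))

  eval-at : ∀ z {u w} → z (L (z la) (z lb)) ≡ u → z (Q (z lc) (z ld)) ≡ w → f z ≡ z (R u w)
  eval-at z refl refl = eval z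

  at-leaves : ∀ (z : Fin n → Fin κ) (S : Fin κ → Fin κ → Fin n) {l l′ a b v} →
              z l ≡ a → z l′ ≡ b → z (S a b) ≡ v → z (S (z l) (z l′)) ≡ v
  at-leaves z S refl refl e = e

mirror : {f : (Fin n → Fin κ) → Fin κ} → Tree₃ f → Tree₃ f
mirror T = record
  { R = flip R ; L = Q ; Q = L ; la = lc ; lb = ld ; lc = la ; ld = lb
  ; eval = eval
  ; asg = λ r l q a b c d → asg (flip r) q l c d a b
  ; asg-R = λ u w → asg-R w u ; asg-L = asg-Q ; asg-Q = asg-L
  ; asg-la = asg-lc ; asg-lb = asg-ld ; asg-lc = asg-la ; asg-ld = asg-lb
  ; size = λ p → trans (size p)
      (cong₂ _+_ (sym (count₂-flip (λ u w → p (R u w)))) (+-comm (count₂ (λ u w → p (L u w)) + _) _))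
  }
  where open Tree₃ T

transposeL : {f : (Fin n → Fin κ) → Fin κ} → Tree₃ f → Tree₃ f
transposeL T = record
  { R = R ; L = flip L ; Q = Q ; la = lb ; lb = la ; lc = lc ; ld = ld
  ; eval = eval
  ; asg = λ r l q a b c d → asg r (flip l) q b a c d
  ; asg-R = asg-R ; asg-L = λ u w → asg-L w u ; asg-Q = asg-Q
  ; asg-la = asg-lb ; asg-lb = asg-la ; asg-lc = asg-lc ; asg-ld = asg-ld
  ; size = λ p → trans (size p)
      (cong (λ s → count₂ (λ u w → p (R u w)) + (s + (count₂ (λ u w → p (Q u w)) + (bit (p lc) + bit (p ld)))))
        (cong₂ _+_ (sym (count₂-flip (λ u w → p (L u w)))) (+-comm (bit (p la)) _)))
  }
  where open Tree₃ T

module Height3 {f : (Fin n → Fin κ) → Fin κ} (f-ext : Extensional f) (A : Subset n)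
               (o : Fin κ) (fresh : Fin κ → Fin κ) (fresh≢ : ∀ x → fresh x ≢ x) where

  private
    p = lookup A

  -- In each alternative, after a suitable assignment to `A`, a column can give the right subtree
  -- any value.
  RightFree : Tree₃ f → Set
  RightFree T = (∃₂ λ c d → p (Q c d) ≡ false) ⊎ p lc ≡ false ⊎ p ld ≡ false
    where open Tree₃ T

  module _ (T : Tree₃ f) where
    open Tree₃ T

    -- A variable of the right subtree outside A lets the columns of the root matrix be chosen freely.
    root-row : ∀ {t} u (w : Fin t → Fin κ) → (∀ {i j} → w i ≡ w j → i ≡ j) →
               (∀ i → p (R u (w i)) ≡ true) → RightFree T → κ ^ t ≤ nrows f A
    root-row {t} u w inj inA free = reading free
      where
      α : (Fin κ → Fin κ → Fin κ) → (c d : Fin κ) → (Fin t → Fin κ) → Fin n → Fin κ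
      α q c d v = asg (λ _ → search FP._≟_ w v o) (λ _ _ → u) q o o c d
      β : (Fin κ → Fin κ → Fin κ) → (c d : Fin κ) → Fin n → Fin κ
      β q c d = asg (λ _ _ → o) (λ _ _ → u) q o o c d
      reads : ∀ {q c d q′ c′ d′} v i → let z = merge A (α q c d v) (β q′ c′ d′) in
              z (Q (z lc) (z ld)) ≡ w i → f z ≡ v i
      reads {q} {c} {d} {q′} {c′} {d′} v i e = trans
        (eval-at (merge A α′ β′) (mix-same {p = p} {α′} {β′} (asg-L _ _) (asg-L _ _)) e)
        (trans (mix-in {p = p} {α′} {β′} (inA i)) (trans (asg-R u (w i)) (search-hit FP._≟_ w v o inj i)))
        where
        α′ = α q c d v
        β′ = β q′ c′ d′
      reading : RightFree T → κ ^ t ≤ nrows f A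
      reading (inj₁ (c , d , out)) = ^-≤-nrows f-ext A t (α (λ _ _ → o) c d) (λ i → β (λ _ _ → w i) c d)
        λ v i → let α′ = α (λ _ _ → o) c d v ; β′ = β (λ _ _ → w i) c d in reads v i
          (at-leaves (merge A α′ β′) Q (mix-same {p = p} {α′} {β′} asg-lc asg-lc) (mix-same {p = p} {α′} {β′} asg-ld asg-ld)
            (trans (mix-out {p = p} {α′} {β′} out) (asg-Q c d)))
      -- With `Q` filled by `const` the right value is the label of `lc`, so this free leaf steers
      -- the root column. `flip const` does the same for `ld`.
      reading (inj₂ (inj₁ out)) = ^-≤-nrows f-ext A t (α const o o) (λ i → β const (w i) o)
        λ v i → let α′ = α const o o v ; β′ = β const (w i) o in reads v i
          (trans (mix-same {p = p} {α′} {β′} (asg-Q _ _) (asg-Q _ _)) (trans (mix-out {p = p} {α′} {β′} out) asg-lc))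
      reading (inj₂ (inj₂ out)) = ^-≤-nrows f-ext A t (α (flip const) o o) (λ i → β (flip const) o (w i))
        λ v i → let α′ = α (flip const) o o v ; β′ = β (flip const) o (w i) in reads v i
          (trans (mix-same {p = p} {α′} {β′} (asg-Q _ _) (asg-Q _ _)) (trans (mix-out {p = p} {α′} {β′} out) asg-ld))

    -- The free leaf moves along row `a` of `L`, and the root matrix `const` passes the left value
    -- on to the output.
    left-row : ∀ {t} a (b : Fin t → Fin κ) → (∀ {i j} → b i ≡ b j → i ≡ j) →
               (∀ i → p (L a (b i)) ≡ true) → p lb ≡ false → κ ^ t ≤ nrows f A
    left-row {t} a b inj inA out = ^-≤-nrows f-ext A t α β λ v i → trans
      (eval-at (merge A (α v) (β i))
        (at-leaves (merge A (α v) (β i)) L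
          (mix-same {p = p} {α v} {β i} asg-la asg-la) (trans (mix-out {p = p} {α v} {β i} out) asg-lb)
          (trans (mix-in {p = p} {α v} {β i} (inA i)) (trans (asg-L a (b i)) (search-hit FP._≟_ b v o inj i))))
        refl)
      (mix-same {p = p} {α v} {β i} (asg-R (v i) _) (asg-R (v i) _))
      where
      α : (Fin t → Fin κ) → Fin n → Fin κ
      α v = asg const (λ _ → search FP._≟_ b v o) (λ _ _ → o) a o o o
      β : Fin t → Fin n → Fin κ
      β i = asg const (λ _ _ → o) (λ _ _ → o) a (b i) o o

    -- The entry of `L` in `A` sets the left value to any `u`, while `lc` and `ld` point to any
    -- entry of `Q` outside `A`. The free entry in row `u` of the root matrix makes the pair
    -- visible.
    all-leaves : p la ≡ true → p lb ≡ true → p lc ≡ true → p ld ≡ true →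
                 ∀ a₀ b₀ → p (L a₀ b₀) ≡ true → (∀ u → ∃ λ w → p (R u w) ≡ false) →
                 κ * count₂ (λ u w → not (p (Q u w))) ≤ nrows f A
    all-leaves in-a in-b in-c in-d a₀ b₀ in-L free =
      ≤-nrows f-ext (remQuot {κ} P) (remQuot-injective {κ} P) A (uncurry α) λ (u , i) (u′ , j) → separated u i u′ j
      where
      P = count₂ (λ u w → not (p (Q u w)))
      entry = proj₁ (enumerate₂ (λ u w → not (p (Q u w))))
      entry∉ : ∀ i → p (uncurry Q (entry i)) ≡ false
      entry∉ i with p (uncurry Q (entry i)) | proj₁ (proj₂ (enumerate₂ (λ u w → not (p (Q u w))))) i
      ... | false | _ = refl
      entry-inj = proj₂ (proj₂ (enumerate₂ (λ u w → not (p (Q u w)))))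
      α : Fin κ → Fin P → Fin n → Fin κ
      α u i = asg (λ _ _ → o) (λ _ _ → u) (λ _ _ → o) a₀ b₀ (proj₁ (entry i)) (proj₂ (entry i))
      value : ∀ u i β → f (merge A (α u i) β) ≡ merge A (α u i) β (R u (β (uncurry Q (entry i))))
      value u i β = eval-at (merge A α′ β)
        (at-leaves (merge A α′ β) L (trans (mix-in {p = p} {α′} {β} in-a) asg-la) (trans (mix-in {p = p} {α′} {β} in-b) asg-lb)
          (trans (mix-in {p = p} {α′} {β} in-L) (asg-L a₀ b₀)))
        (at-leaves (merge A α′ β) Q (trans (mix-in {p = p} {α′} {β} in-c) asg-lc) (trans (mix-in {p = p} {α′} {β} in-d) asg-ld)
          (mix-out {p = p} {α′} {β} (entry∉ i)))
        where α′ = α u i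
      -- β routes only the pair (u , i) to the entry (u , w) of the root matrix, the one entry not equal to o.
      separated : ∀ u i u′ j → (∀ β → f (merge A (α u i) β) ≡ f (merge A (α u′ j) β)) → (u , i) ≡ (u′ , j)
      separated u i u′ j same with (u′ FP.≟ u) ×-dec (j FP.≟ i)
      ... | yes (refl , refl) = refl
      ... | no ne = contradiction
        (trans (sym hit) (trans (sym (value u i β)) (trans (same β) (trans (value u′ j β) miss))))
        (fresh≢ o)
        where
        w = proj₁ (free u)
        β = asg (spot (u , w) (fresh o) o) (λ _ _ → o) (spot (entry i) w (fresh w)) o o o o
        hit : merge A (α u i) β (R u (β (uncurry Q (entry i)))) ≡ fresh o
        hit = trans (cong (λ w → merge A (α u i) β (R u w)) (trans (asg-Q _ _) (spot-hit (entry i))))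
          (trans (mix-out {p = p} {α u i} {β} (proj₂ (free u))) (trans (asg-R u w) (spot-hit (u , w))))
        elsewhere : ∀ w′ → (u′ , w′) ≢ (u , w) → merge A (α u′ j) β (R u′ w′) ≡ o
        elsewhere w′ ne = mix-same {p = p} {α u′ j} {β} (asg-R u′ w′) (trans (asg-R u′ w′) (spot-miss ne))
        miss : merge A (α u′ j) β (R u′ (β (uncurry Q (entry j)))) ≡ o
        miss = elsewhere _ λ e → contradiction
          (trans (sym (spot-miss (λ e′ → ne (cong proj₁ e , entry-inj e′)))) (trans (sym (asg-Q _ _)) (cong proj₂ e)))
          (fresh≢ w)

  -- The budget exceeds one full subtree, both leaves of the other one and s entries per row in two of
  -- the matrices; past s entries in a single row there are at least κ^(s+1) rows.
  module Budget (s : ℕ) (2s<κ : 2 * s < κ) (16s≤7κ : 16 * s ≤ 7 * κ) (κ³≤ : κ ^ 3 ≤ 16 * κ ^ suc s)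
                (budget : count p ≡ 4 + (κ * κ + 2 * (s * κ))) where

    private
      Goal : Set
      Goal = κ ^ 3 ≤ 16 * nrows f A

      goal-power : κ ^ suc s ≤ nrows f A → Goal
      goal-power le = ≤-trans κ³≤ (*-monoʳ-≤ 16 le)

      s<κ : suc s ≤ κ
      s<κ = ≤-trans (s≤s (m≤m+n s _)) 2s<κ

      2sκ<κ² : 2 * (s * κ) < κ * κ
      2sκ<κ² = subst (_< κ * κ) (*-assoc 2 s κ) (*-monoˡ-< κ ⦃ >-nonZero (≤-trans (s≤s z≤n) s<κ) ⦄ 2s<κ)

    -- Any `s + 1` entries of `A` in one root row reach the goal by `root-row`. This covers a dense
    -- row found by pigeonhole and also a fully occupied row, since `s + 1 ≤ κ`.
    sparse-rows : (T : Tree₃ f) → let open Tree₃ T in RightFree T →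
      Goal ⊎ (count₂ (λ u w → p (R u w)) ≤ s * κ × (∀ u → ∃ λ w → p (R u w) ≡ false))
    sparse-rows T free with row-fibres (λ u w → p (Tree₃.R T u w)) s
    ... | inj₁ (u , w , inj , inA) = inj₁ (goal-power (root-row T u w inj inA free))
    ... | inj₂ few with FP.all? (λ u → FP.any? λ w → p (Tree₃.R T u w) ≟ᵇ false)
    ...   | yes each = inj₂ (few , each)
    ...   | no ¬each =
      let u , full = FP.¬∀⟶∃¬ κ _ (λ u → FP.any? λ w → p (Tree₃.R T u w) ≟ᵇ false) ¬each
      in inj₁ (goal-power (root-row T u (λ i → inject≤ i s<κ) (FP.inject≤-injective s<κ s<κ _ _)
                (λ i → occupied (λ e → full (_ , e))) free))
      where
      occupied : ∀ {b} → b ≢ false → b ≡ true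
      occupied {true}  _  = refl
      occupied {false} ne = contradiction refl ne

    -- If neither the columns of `R` nor the rows of `L` reach the goal, each matrix has at most
    -- `sκ` entries in `A`. Even with all of `Q` and the other three leaves, `A` stays one variable
    -- short of the budget.
    free-leaf : (T : Tree₃ f) → p (Tree₃.lb T) ≡ false → Goal
    free-leaf T out with sparse-rows (mirror T) (inj₂ (inj₂ out)) | row-fibres (λ u w → p (Tree₃.L T u w)) s
    ... | inj₁ goal | _ = goal
    ... | inj₂ _ | inj₁ (a , b , inj , inA) = goal-power (left-row T a b inj inA out)
    ... | inj₂ (few , _) | inj₂ few′ = contradiction total (<⇒≱ (≤-reflexive (sym budget′)))
      where
      open Tree₃ T
      open ≤-Reasoning
      bit≤1 : ∀ b → bit b ≤ 1
      bit≤1 true  = ≤-refl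
      bit≤1 false = z≤n
      budget′ : count p ≡ suc (3 + (κ * κ + 2 * (s * κ)))
      budget′ = budget
      regroup : ∀ x y → x + ((x + 1) + (y + 2)) ≡ 3 + (y + 2 * x)
      regroup = solve-∀
      total : count p ≤ 3 + (κ * κ + 2 * (s * κ))
      total = begin
        count p
          ≡⟨ size p ⟩
        _
          ≤⟨ +-mono-≤ (subst (_≤ s * κ) (count₂-flip (λ u w → p (R u w))) few)
               (+-mono-≤
                 (+-mono-≤ few′ (+-mono-≤ (bit≤1 (p la)) (≤-reflexive (cong bit out))))
                 (+-mono-≤ (count₂≤ (λ u w → p (Q u w))) (+-mono-≤ (bit≤1 (p lc)) (bit≤1 (p ld))))) ⟩
        s * κ + ((s * κ + 1) + (κ * κ + 2))
          ≡⟨ regroup (s * κ) (κ * κ) ⟩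
        3 + (κ * κ + 2 * (s * κ)) ∎

    -- Since `Q` has at most as many entries in `A` as `L`, it has at most half of the `κ² + 2sκ`
    -- available, so `P`, the number of its entries outside `A`, is at least `(κ² − 2sκ)/2`.
    fixed-leaves : (T : Tree₃ f) → let open Tree₃ T in
      p la ≡ true → p lb ≡ true → p lc ≡ true → p ld ≡ true →
      count₂ (λ u w → p (Q u w)) ≤ count₂ (λ u w → p (L u w)) → Goal
    fixed-leaves T ea eb ec ed Q≤L = conclude (sparse-rows T (inj₁ (_ , _ , free-entry)))
      where
      open Tree₃ T
      open ≤-Reasoning
      cR = count₂ (λ u w → p (R u w))
      cL = count₂ (λ u w → p (L u w))
      cQ = count₂ (λ u w → p (Q u w))
      P  = count₂ (λ u w → not (p (Q u w)))
      total : cR + (cL + cQ) ≡ κ * κ + 2 * (s * κ)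
      total = +-cancelˡ-≡ 4 _ _ (trans (sym (trans (size p) (trans bits (regroup cR cL cQ)))) budget)
        where
        bits : cR + ((cL + (bit (p la) + bit (p lb))) + (cQ + (bit (p lc) + bit (p ld)))) ≡
               cR + ((cL + 2) + (cQ + 2))
        bits = cong (cR +_) (cong₂ _+_ (cong (cL +_) (cong₂ (λ x y → bit x + bit y) ea eb))
                                       (cong (cQ +_) (cong₂ (λ x y → bit x + bit y) ec ed)))
        regroup : ∀ r l q → r + ((l + 2) + (q + 2)) ≡ 4 + (r + (l + q))
        regroup = solve-∀
      Q+P : cQ + P ≡ κ * κ
      Q+P = count₂-not (λ u w → p (Q u w))
      κ²≤2sκ+2P : κ * κ ≤ 2 * (s * κ) + 2 * P
      κ²≤2sκ+2P = +-cancelˡ-≤ (κ * κ) _ _ (begin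
        κ * κ + κ * κ                       ≡⟨ cong₂ _+_ Q+P Q+P ⟨
        (cQ + P) + (cQ + P)                 ≡⟨ regroup cQ P ⟩
        (cQ + cQ) + 2 * P                   ≤⟨ +-monoˡ-≤ (2 * P) (+-monoˡ-≤ cQ Q≤L) ⟩
        (cL + cQ) + 2 * P                   ≤⟨ +-monoˡ-≤ (2 * P) (m≤n+m (cL + cQ) cR) ⟩
        cR + (cL + cQ) + 2 * P              ≡⟨ cong (_+ 2 * P) total ⟩
        κ * κ + 2 * (s * κ) + 2 * P         ≡⟨ +-assoc (κ * κ) _ _ ⟩
        κ * κ + (2 * (s * κ) + 2 * P)       ∎)
        where
        regroup : ∀ q r → (q + r) + (q + r) ≡ (q + q) + 2 * r
        regroup = solve-∀
      P>0 : 0 < P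
      P>0 = n≢0⇒n>0 λ P≡0 → <⇒≱ 2sκ<κ²
        (subst (κ * κ ≤_) (trans (cong (λ P → 2 * (s * κ) + 2 * P) P≡0) (+-identityʳ _)) κ²≤2sκ+2P)
      entry = enumerate₂ (λ u w → not (p (Q u w)))
      free-entry : p (uncurry Q (proj₁ entry (fromℕ< P>0))) ≡ false
      free-entry with p (uncurry Q (proj₁ entry (fromℕ< P>0))) | proj₁ (proj₂ entry) (fromℕ< P>0)
      ... | false | _ = refl
      -- The constant 16 arises here: `16P ≥ 8κ² − 16sκ`, and `16s ≤ 7κ` leaves at least `κ²`.
      κ²≤16P : κ * κ ≤ 16 * P
      κ²≤16P = +-cancelʳ-≤ (7 * (κ * κ)) _ _ (begin
        κ * κ + 7 * (κ * κ)                 ≡⟨⟩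
        8 * (κ * κ)                         ≤⟨ *-monoʳ-≤ 8 κ²≤2sκ+2P ⟩
        8 * (2 * (s * κ) + 2 * P)           ≡⟨ regroup s κ P ⟩
        16 * P + 16 * s * κ                 ≤⟨ +-monoʳ-≤ (16 * P) (*-monoˡ-≤ κ 16s≤7κ) ⟩
        16 * P + 7 * κ * κ                  ≡⟨ cong (16 * P +_) (*-assoc 7 κ κ) ⟩
        16 * P + 7 * (κ * κ)                ∎)
        where
        regroup : ∀ s k P → 8 * (2 * (s * k) + 2 * P) ≡ 16 * P + 16 * s * k
        regroup = solve-∀
      conclude : Goal ⊎ (cR ≤ s * κ × (∀ u → ∃ λ w → p (R u w) ≡ false)) → Goal
      conclude (inj₁ goal)         = goal
      conclude (inj₂ (few , free)) = begin
        κ ^ 3                ≡⟨ cong (λ x → κ * (κ * x)) (*-identityʳ κ) ⟩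
        κ * (κ * κ)          ≤⟨ *-monoʳ-≤ κ κ²≤16P ⟩
        κ * (16 * P)         ≡⟨ regroup κ P ⟩
        16 * (κ * P)         ≤⟨ *-monoʳ-≤ 16 (all-leaves T ea eb ec ed _ _ (proj₁ (proj₂ inL) (fromℕ< cL>0)) free) ⟩
        16 * nrows f A       ∎
        where
        inL = enumerate₂ (λ u w → p (L u w))
        regroup : ∀ k P → k * (16 * P) ≡ 16 * (k * P)
        regroup = solve-∀
        -- If `L` had no entry in `A`, neither would `Q`, and the at most `sκ` entries of `R` could
        -- not fill the budget.
        cL>0 : 0 < cL
        cL>0 = n≢0⇒n>0 λ cL≡0 → <⇒≱ (≤-trans (s≤s z≤n) 2sκ<κ²) (+-cancelʳ-≤ (2 * (s * κ)) (κ * κ) 0 (begin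
          κ * κ + 2 * (s * κ)  ≡⟨ total ⟨
          cR + (cL + cQ)       ≤⟨ +-monoʳ-≤ cR (+-monoʳ-≤ cL Q≤L) ⟩
          cR + (cL + cL)       ≡⟨ cong (λ x → cR + (x + x)) cL≡0 ⟩
          cR + 0               ≡⟨ +-identityʳ cR ⟩
          cR                   ≤⟨ few ⟩
          s * κ                ≤⟨ m≤m+n (s * κ) _ ⟩
          2 * (s * κ)          ∎))

    κ³≤16nrows : Tree₃ f → κ ^ 3 ≤ 16 * nrows f A
    κ³≤16nrows T = cases _ _ _ _ refl refl refl refl
      where
      open Tree₃ T
      cases : ∀ a b c d → p la ≡ a → p lb ≡ b → p lc ≡ c → p ld ≡ d → Goal
      cases false _ _ _ ea _ _ _ = free-leaf (transposeL T) ea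
      cases true false _ _ _ eb _ _ = free-leaf T eb
      cases true true false _ _ _ ec _ = free-leaf (transposeL (mirror T)) ec
      cases true true true false _ _ _ ed = free-leaf (mirror T) ed
      cases true true true true ea eb ec ed
        with ≤-total (count₂ (λ u w → p (Q u w))) (count₂ (λ u w → p (L u w)))
      ... | inj₁ Q≤L = fixed-leaves T ea eb ec ed Q≤L
      ... | inj₂ L≤Q = fixed-leaves (mirror T) ec ed ea eb L≤Q

-- The trees of heights 2 and 3

module _ (k d : ℕ) where

  private
    s = sz k d

  matrixVar : Fin k → Fin k → Fin (sz k (suc d))
  matrixVar u w = combine u w ↑ˡ (s + s)

  leftVar rightVar : Fin s → Fin (sz k (suc d))
  leftVar  i = k * k ↑ʳ (i ↑ˡ s)
  rightVar i = k * k ↑ʳ (s ↑ʳ i)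

  graft : (Fin k → Fin k → Fin k) → (Fin s → Fin k) → (Fin s → Fin k) → Fin (sz k (suc d)) → Fin k
  graft m x y = (uncurry m ∘ remQuot {k} k) ++ (x ++ y)

  module _ (m : Fin k → Fin k → Fin k) (x y : Fin s → Fin k) where

    graft-matrix : ∀ u w → graft m x y (matrixVar u w) ≡ m u w
    graft-matrix u w = trans (lookup-++ˡ (uncurry m ∘ remQuot {k} k) (x ++ y) (combine u w))
      (cong (uncurry m) (FP.remQuot-combine u w))

    graft-left : ∀ i → graft m x y (leftVar i) ≡ x i
    graft-left i = trans (lookup-++ʳ (uncurry m ∘ remQuot {k} k) (x ++ y) (i ↑ˡ s)) (lookup-++ˡ x y i)

    graft-right : ∀ i → graft m x y (rightVar i) ≡ y i
    graft-right i = trans (lookup-++ʳ (uncurry m ∘ remQuot {k} k) (x ++ y) (s ↑ʳ i)) (lookup-++ʳ x y i)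

  count-graft : (p : Fin (sz k (suc d)) → Bool) → count p ≡
    count₂ (λ u w → p (matrixVar u w)) + (count (p ∘ leftVar) + count (p ∘ rightVar))
  count-graft p = trans (count-splitAt (k * k) p) (cong₂ _+_
    (count-cong (λ i → cong (λ i → p (i ↑ˡ (s + s))) (sym (FP.combine-remQuot {k} k i))))
    (count-splitAt s (p ∘ (k * k ↑ʳ_))))

tree₂ : ∀ k → Tree₂ (tep k 1)
tree₂ k = record
  { M = matrixVar k 0 ; la = leftVar k 0 zero ; lb = rightVar k 0 zero
  ; eval = λ _ → refl
  ; asg = λ m a b → graft k 0 m (const a) (const b)
  ; asg-M = λ {m} {a} {b} → graft-matrix k 0 m (const a) (const b)
  ; asg-la = λ {m} {a} {b} → graft-left k 0 m (const a) (const b) zero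
  ; asg-lb = λ {m} {a} {b} → graft-right k 0 m (const a) (const b) zero
  ; size = λ p → trans (count-graft k 0 p)
      (cong (count₂ (λ u w → p (matrixVar k 0 u w)) +_) (cong₂ _+_ (+-identityʳ (bit (p (leftVar k 0 zero)))) (+-identityʳ (bit (p (rightVar k 0 zero))))))
  }

tree₃ : ∀ k → Tree₃ (tep k 2)
tree₃ k = record
  { R = matrixVar k 1
  ; L = λ u w → leftVar k 1 (M u w) ; la = leftVar k 1 la ; lb = leftVar k 1 lb
  ; Q = λ u w → rightVar k 1 (M u w) ; lc = rightVar k 1 la ; ld = rightVar k 1 lb
  ; eval = λ _ → refl
  ; asg = λ r l q a b c d → graft k 1 r (asg l a b) (asg q c d)
  ; asg-R = λ {r} {l} {q} {a} {b} {c} {d} → graft-matrix k 1 r (asg l a b) (asg q c d)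
  ; asg-L = λ {r} {l} {q} {a} {b} {c} {d} u w → trans (graft-left k 1 r (asg l a b) (asg q c d) _) (asg-M u w)
  ; asg-Q = λ {r} {l} {q} {a} {b} {c} {d} u w → trans (graft-right k 1 r (asg l a b) (asg q c d) _) (asg-M u w)
  ; asg-la = λ {r} {l} {q} {a} {b} {c} {d} → trans (graft-left k 1 r (asg l a b) (asg q c d) _) (asg-la {l})
  ; asg-lb = λ {r} {l} {q} {a} {b} {c} {d} → trans (graft-left k 1 r (asg l a b) (asg q c d) _) (asg-lb {l})
  ; asg-lc = λ {r} {l} {q} {a} {b} {c} {d} → trans (graft-right k 1 r (asg l a b) (asg q c d) _) (asg-la {q})
  ; asg-ld = λ {r} {l} {q} {a} {b} {c} {d} → trans (graft-right k 1 r (asg l a b) (asg q c d) _) (asg-lb {q})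
  ; size = λ p → trans (count-graft k 1 p)
      (cong (count₂ (λ u w → p (matrixVar k 1 u w)) +_)
        (cong₂ _+_ (size (p ∘ leftVar k 1)) (size (p ∘ rightVar k 1))))
  }
  where open Tree₂ (tree₂ k)

fresh : 2 ≤ κ → Fin κ → Fin κ
fresh (s≤s (s≤s _)) zero    = suc zero
fresh (s≤s (s≤s _)) (suc _) = zero

fresh≢ : (2≤κ : 2 ≤ κ) → ∀ x → fresh 2≤κ x ≢ x
fresh≢ (s≤s (s≤s _)) zero    ()
fresh≢ (s≤s (s≤s _)) (suc _) ()

-- Exact value at height 2 and lower bound at height 3

Sℓ-height2 : ∀ k → 2 ≤ k → ∀ ℓ → k ≤ ℓ → ℓ ≤ suc k → Sℓ (TEP k 2) (suc ℓ) ≡ k * k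
Sℓ-height2 k 2≤k ℓ k≤ℓ ℓ≤1+k = ≤-antisym
  (Upper⇒Sℓ≤ (tep-ext k 1) (Upper-height2 k ℓ (<⇒≤ 2≤k) ℓ≤n))
  (Sℓ-elim (tep k 1) (k * k ≤_) ℓ≤n λ A ∣A∣≡ℓ → let c = trans (sym (∣∣≡count A)) ∣A∣≡ℓ in
    Height2.κ²≤nrows (tep-ext k 1) A (fromℕ< (<⇒≤ 2≤k)) (fresh 2≤k) (fresh≢ 2≤k) (tree₂ k) 2≤k
      (subst (suc k ≤_) (sym c) (s≤s k≤ℓ)) (subst (_≤ 2 + k) (sym c) (s≤s ℓ≤1+k)))
  where
  ℓ≤n : suc ℓ ≤ sz k 1
  ℓ≤n = ≤-trans (s≤s ℓ≤1+k) (subst (2 + k ≤_) (+-comm 2 (k * k)) (+-monoʳ-≤ 2 (k≤k² k)))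

Smax-height2 : ∀ k → 2 ≤ k → Smax (TEP k 2) ≡ k * k
Smax-height2 k 2≤k = ≤-antisym (Smax-height2≤ k 2≤k)
  (subst (_≤ Smax (TEP k 2)) (Sℓ-height2 k 2≤k k ≤-refl (n≤1+n k))
    (Sℓ≤Smax (tep k 1) (subst (suc k ≤_) (+-comm 2 (k * k)) (s≤s (≤-trans (k≤k² k) (n≤1+n (k * k)))))))

Smax-height3≥ : ∀ k s → 2 ≤ k → 2 * s < k → 16 * s ≤ 7 * k → k ^ 3 ≤ 16 * k ^ suc s → k ^ 3 ≤ 16 * Smax (TEP k 3)
Smax-height3≥ k s 2≤k 2s<k 16s≤7k k³≤ = ≤-trans
  (Sℓ-elim (tep k 2) (λ N → k ^ 3 ≤ 16 * N) ℓ≤n λ A ∣A∣≡ℓ →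
    Height3.Budget.κ³≤16nrows (tep-ext k 2) A (fromℕ< (<⇒≤ 2≤k)) (fresh 2≤k) (fresh≢ 2≤k)
      s 2s<k 16s≤7k k³≤ (trans (sym (∣∣≡count A)) ∣A∣≡ℓ) (tree₃ k))
  (*-monoʳ-≤ 16 (Sℓ≤Smax (tep k 2) ℓ≤n))
  where
  open ≤-Reasoning
  regroup : ∀ x → 4 + (x + (x + x)) ≡ x + ((x + 2) + (x + 2))
  regroup = solve-∀
  -- The size fits because `2sk ≤ k²` and the tree has `3k² + 4` variables.
  ℓ≤n : 4 + (k * k + 2 * (s * k)) ≤ sz k 2
  ℓ≤n = begin
    4 + (k * k + 2 * (s * k))         ≡⟨ cong (λ x → 4 + (k * k + x)) (*-assoc 2 s k) ⟨
    4 + (k * k + 2 * s * k)           ≤⟨ +-monoʳ-≤ 4 (+-monoʳ-≤ (k * k) (*-monoˡ-≤ k (<⇒≤ 2s<k))) ⟩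
    4 + (k * k + k * k)               ≤⟨ +-monoʳ-≤ 4 (+-monoʳ-≤ (k * k) (m≤m+n (k * k) _)) ⟩
    4 + (k * k + (k * k + k * k))     ≡⟨ regroup (k * k) ⟩
    k * k + ((k * k + 2) + (k * k + 2)) ∎

theorem4p4 : (k : ℕ) → 2 ≤ k →
    ((Smax (TEP k 2) ≡ k * k)
    × (Sℓ (TEP k 2) (k + 1) ≡ k * k)
    × (Sℓ (TEP k 2) (k + 2) ≡ k * k))
    × (4 ≤ k → k ^ 3 ≤ 16 * Smax (TEP k 3))
    × ((h : ℕ) → 3 ≤ h →
    (Smax (TEP k h) ≤ k ^ h ∸ k ^ (h ∸ 2) * (k ∸ 2))
    × (3 ≤ k → Smax (TEP k h) < k ^ h))
theorem4p4 k 2≤k =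
  (Smax-height2 k 2≤k ,
   subst (λ ℓ → Sℓ (TEP k 2) ℓ ≡ k * k) (+-comm 1 k) (Sℓ-height2 k 2≤k k ≤-refl (n≤1+n k)) ,
   subst (λ ℓ → Sℓ (TEP k 2) ℓ ≡ k * k) (+-comm 2 k) (Sℓ-height2 k 2≤k (suc k) (n≤1+n k) ≤-refl)) ,
  height3 ,
  height≥3
  where
  height3 : 4 ≤ k → k ^ 3 ≤ 16 * Smax (TEP k 3)
  -- With `s = 2` a dense row already gives `k³` rows, but `2s < k` requires `k ≥ 5`. For `k = 4`
  -- and `s = 1` it gives `4²`, enough since `64 ≤ 16 · 16`.
  height3 4≤k with m≤n⇒m<n∨m≡n 4≤k
  ... | inj₁ 5≤k = Smax-height3≥ k 2 2≤k 5≤k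
    (≤-trans (m≤m+n 32 3) (*-monoʳ-≤ 7 5≤k)) (m≤m+n (k ^ 3) _)
  ... | inj₂ 4≡k = Smax-height3≥ k 1 2≤k
    (subst (2 <_) 4≡k (m≤m+n 3 1)) (subst (λ k → 16 ≤ 7 * k) 4≡k (m≤m+n 16 12))
    (subst (λ k → k ^ 3 ≤ 16 * k ^ 2) 4≡k (m≤m+n 64 192))
  nonZero = >-nonZero (<⇒≤ 2≤k)
  height≥3 : ∀ h → 3 ≤ h → (Smax (TEP k h) ≤ k ^ h ∸ k ^ (h ∸ 2) * (k ∸ 2)) × (3 ≤ k → Smax (TEP k h) < k ^ h)
  height≥3 (suc (suc (suc d))) (s≤s (s≤s (s≤s _))) = bounded , λ 3≤k →
    -- The subtracted term is positive for `k ≥ 3`, and by `deficit` it does not exceed `k^h`, so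
    -- truncated subtraction strictly decreases.
    <-≤-trans (s≤s bounded) (∸-monoʳ-< {k ^ (3 + d)} (*-mono-≤ (m^n>0 k ⦃ nonZero ⦄ (suc d)) (m<n⇒0<n∸m 3≤k)) deficit)
    where
    bounded = Smax-height≥3≤ k 2≤k d
    deficit : k ^ suc d * (k ∸ 2) ≤ k ^ (3 + d)
    deficit = begin
      k ^ suc d * (k ∸ 2)  ≤⟨ *-monoʳ-≤ (k ^ suc d) (m∸n≤m k 2) ⟩
      k ^ suc d * k        ≡⟨ *-comm (k ^ suc d) k ⟩
      k ^ (2 + d)          ≤⟨ ^-monoʳ-≤ k ⦃ nonZero ⦄ (n≤1+n (2 + d)) ⟩
      k ^ (3 + d)          ∎
      where open ≤-Reasoning
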